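{- Let $S$ be a string with $z$ LZ77-factors. Then there are at most $73(\log_2 |S|)(z+2)^2$ runs in the run-length Burrows-Wheeler transform (RLBWT) of $S$.
   Context: A string $S=S[1]S[2]\cdots S[|S|]$ is a finite sequence of characters from an alphabet $\Sigma$. One sets $S[0]=S[|S|+1]=\$$ for a symbol $\$\notin\Sigma$, and $\Sigma\cup\{\$\}$ is totally ordered. For $i>j$ the substring $S[i..j]$ is empty. The (self-referential) LZ77-decomposition of $S$ is the factorization $S=F_1F_2\cdots F_z$ such that, for each $i$, either $F_i$ is a single character which does not occur in $F_1\cdots F_{i-1}$, or $F_i$ is the longest possible prefix of $S[|F_1\cdots F_{i-1}|+1..|S|]$ which occurs at least twice in $F_1\cdots F_i$. The $F_i$ are the LZ77-factors and $z$ is their number. Burrows-Wheeler transform: let $\pi_1,\pi_2,\dots,\pi_{|S|+1}$ be the enumeration of $\{0,1,\dots,|S|\}$ for which the rotations $S[\pi_i+1..|S|+1]\,S[1..\pi_i]$ of $S\$$ are in increasing lexicographic order. The Burrows-Wheeler transform of $S$ is the sequence of last characters of these rotations, i.e. $S[\pi_1]S[\pi_2]\cdots S[\pi_{|S|+1}]$ (where $S[0]=\$$). The runs of the RLBWT are the maximal blocks of consecutive equal characters in this sequence, so a run starts at index $1$ and at each index $i\ge 2$ with $S[\pi_{i-1}]\neq S[\pi_i]$.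
   Formalization: The formal theorem assumes |S| ≥ 2: for |S| = 1 the stated bound is 73·0·9 = 0 while the BWT has 2 runs, and for |S| = 0 the logarithm is undefined. -}

module Defs where

open import Level using (Level; _⊔_)
open import Data.Nat using (ℕ; zero; suc; _^_; _≤_)
open import Data.Fin using (Fin; toℕ; _<_)
open import Data.Fin.Permutation using (Permutation′; _⟨$⟩ʳ_)
open import Data.List
  using (List; []; _∷_; [_]; _++_; concat; derun; drop; head; length; lookup; map; tabulate; take)
open import Data.List.Membership.Propositional using (_∉_)
open import Data.List.Relation.Binary.Lex.Strict using (Lex-<)
open import Data.List.Relation.Binary.Prefix.Heterogeneous using (Prefix)
open import Data.Maybe using (Maybe; just; nothing)
open import Data.Product using (∃-syntax; _×_)
open import Data.Sum using (_⊎_)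
open import Relation.Binary using (Rel; DecidableEquality)
open import Relation.Binary.PropositionalEquality using (_≡_; _≢_)

private
  variable
    a ℓ : Level
    A : Set a

-- x ≤ c · log₂ n over the reals, for x, c ∈ ℕ and n ≥ 1: since t ↦ 2ᵗ is
-- strictly increasing, this says 2ˣ ≤ 2^(c · log₂ n) = nᶜ.
infix 4 _≤_·log₂_
_≤_·log₂_ : ℕ → ℕ → ℕ → Set
x ≤ c ·log₂ n = 2 ^ x ≤ n ^ c

-- Occurrences are identified by their starting offset, so distinct occurrences
-- may overlap.
OccursAt : {A : Set a} → List A → List A → ℕ → Set a
OccursAt W T p = ∃[ U ] ∃[ V ] (T ≡ U ++ W ++ V × length U ≡ p)

OccursTwice : {A : Set a} → List A → List A → Set a
OccursTwice W T = ∃[ p ] ∃[ q ] (p ≢ q × OccursAt W T p × OccursAt W T q)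

IsNewCharacter : {A : Set a} → List A → List A → Set a
IsNewCharacter P F = ∃[ c ] (F ≡ [ c ] × c ∉ P)

-- P is the part of the string already factorized and R the part that remains.
-- Factors are nonempty: the empty string occurs in P ++ [] once per offset, so
-- without F ≢ [] an empty factor could be inserted before every new character.
IsLongestRepeat : {A : Set a} → List A → List A → List A → Set a
IsLongestRepeat P R F =
    F ≢ []
  × Prefix _≡_ F R
  × OccursTwice F (P ++ F)
  × (∀ G → Prefix _≡_ G R → OccursTwice G (P ++ G) → length G ≤ length F)

IsLZ77 : {A : Set a} → List A → List (List A) → Set a
IsLZ77 S Fs =
    S ≡ concat Fs
  × ((i : Fin (length Fs)) →
       let P = concat (take (toℕ i) Fs)
           R = drop (length P) S
           F = lookup Fs i
       in IsNewCharacter P F ⊎ IsLongestRepeat P R F)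

-- The sentinel $ is nothing. Positions count from 1, and
-- S ⟦ 0 ⟧ = S ⟦ suc (length S) ⟧ = $.
_⟦_⟧ : {A : Set a} → List A → ℕ → Maybe A
S ⟦ zero ⟧  = nothing
S ⟦ suc i ⟧ = head (drop i S)

-- S[i+1..|S|+1] S[1..i], for i ≤ |S|; its last character is S ⟦ i ⟧.
rotation : {A : Set a} → List A → ℕ → List (Maybe A)
rotation S i = map just (drop i S) ++ nothing ∷ map just (take i S)

-- The i-th rotation in the enumeration is the one at toℕ (π ⟨$⟩ʳ i), with i
-- counting from 0. Distinct rotations differ, since $ occurs once in each.
SortsRotations : {A : Set a} → Rel (Maybe A) ℓ → (S : List A) →
                 Permutation′ (suc (length S)) → Set (a ⊔ ℓ)
SortsRotations _≺_ S π =
  ∀ {i j} → i < j →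
    Lex-< _≡_ _≺_ (rotation S (toℕ (π ⟨$⟩ʳ i))) (rotation S (toℕ (π ⟨$⟩ʳ j)))

bwt : {A : Set a} → (S : List A) → Permutation′ (suc (length S)) → List (Maybe A)
bwt S π = tabulate λ i → S ⟦ toℕ (π ⟨$⟩ʳ i) ⟧

-- derun collapses each maximal block of equal consecutive entries to one entry.
runs : DecidableEquality A → List A → ℕ
runs _≟_ xs = length (derun _≟_ xs)

-- A change in the BWT comes from two neighbouring suffixes of $S$ with different
-- preceding characters. Let W be their longest common prefix. Every factor of $S$
-- of length at least 2 has a copy that crosses one of the z + 1 phrase starts, so
-- W has a copy at a phrase start β that agrees with the lower suffix, and one at
-- β′ that agrees with the upper suffix, including the characters around W.
--
-- Let e be the amount by which the first copy reaches further to the left of β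
-- than the second one to the left of β′ (the opposite case is symmetric under
-- reversal of the order). Then T[β ∸ e .. β) = T[β′ .. β′ + e). If two changes
-- share β and β′, and e < e′ lie in the same third of an octave, then this word
-- has the period e′ ∸ e, hence a short least period p. Both copies of both W's are
-- maximal matches, so, unless the two p-periodic runs around β and β′ are aligned
-- at an end (which fixes e), each W starts where one of the runs starts and ends
-- where one of them ends. If W is determined by a single run, the two changes
-- coincide. If W starts with one run and ends with the other, then neighbourhood
-- in the suffix order forces the run of the suffix with the shorter W to end less
-- than p after W. Such runs are counted directly: by the Fine–Wilf argument two of
-- them at the same phrase start, of similar length and position, coincide.
--
-- With n < 2 ^ L ≤ 2 n this gives at most (z + 1)² (36 L + 1) + 60 (z + 1) L changes.

module Submission where

open import Defs
open import Level using (Level; _⊔_)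
open import Data.Nat hiding (_⊔_; _≟_; compare)
open import Data.Nat.Properties hiding (_≟_)
open import Data.Nat.Tactic.RingSolver using (solve)
open import Data.Fin as Fin using (Fin; toℕ; fromℕ<)
open import Data.Fin.Patterns
import Data.Fin.Properties as Fin
open import Data.Fin.Permutation using (Permutation′; _⟨$⟩ʳ_; _⟨$⟩ˡ_; inverseʳ; inverseˡ)
open import Data.List using (List; []; _∷_; _++_; length; head; drop; take; concat; map; tabulate;
    derun; lookup)
open import Data.List.Properties using (length-++; ++-assoc; length-drop)
open import Data.List.Relation.Binary.Lex.Core using (this; next)
open import Data.List.Relation.Binary.Lex.Strict using (Lex-<)
open import Data.Maybe using (Maybe; just; nothing)
open import Data.Product using (∃; ∃-syntax; Σ; _×_; _,_; proj₁; proj₂)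
open import Data.Sum using (_⊎_; inj₁; inj₂; [_,_]′)
open import Data.Empty using (⊥; ⊥-elim)
open import Function using (_∘_; flip; Injective; _↔_; Inverse)
open import Function.Construct.Composition using (_↔-∘_)
open import Function.Construct.Identity using (↔-id)
open import Data.Product.Function.NonDependent.Propositional using (_×-↔_)
open import Data.Sum.Function.Propositional using (_⊎-↔_)
open import Relation.Nullary using (¬_; Dec; yes; no; contradiction)
open import Relation.Nullary.Decidable using (map′; _×-dec_; _→-dec_; ¬?)
open import Relation.Binary using (Rel; DecidableEquality; IsStrictTotalOrder; tri<; tri≈; tri>)
open import Relation.Binary.PropositionalEquality hiding ([_])

private
  variable
    α ℓ : Level

-- Certificates for linear inequalities and bounded search

infixr 6 _⊕_
infixr 7 _⊛_
_⊕_ : ∀ {a b c d} → a ≤ b → c ≤ d → a + c ≤ b + d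
_⊕_ = +-mono-≤

_⊛_ : ∀ c {a b} → a ≤ b → c * a ≤ c * b
c ⊛ a≤b = *-monoʳ-≤ c a≤b

-- Certificates for linear inequalities: the hypotheses are added up to A ≤ B, and
-- the goal follows by a semiring identity.
lin : ∀ {a b A B} slack → A ≤ B → a + B + slack ≡ b + A → a ≤ b
lin {a} {b} {A} {B} slack A≤B eq = +-cancelʳ-≤ A a b (begin
  a + A          ≤⟨ +-monoʳ-≤ a A≤B ⟩
  a + B          ≤⟨ m≤m+n (a + B) slack ⟩
  a + B + slack  ≡⟨ eq ⟩
  b + A          ∎)
  where open ≤-Reasoning

-- For certificates with denominator `g`: the hypotheses only have to yield `g * a < g * suc b`, and
-- integrality rounds this down to `a ≤ b`.
linᵍ : ∀ g {a b A B} slack → A ≤ B → g * a + B + suc slack ≡ g * suc b + A → a ≤ b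
linᵍ g {a} {b} {A} {B} slack A≤B eq =
    ≤-pred (*-cancelˡ-< g a (suc b) (+-cancelʳ-< A (g * a) (g * suc b) (begin-strict
  g * a + A              ≤⟨ +-monoʳ-≤ (g * a) A≤B ⟩
  g * a + B              <⟨ m<m+n (g * a + B) z<s ⟩
  g * a + B + suc slack  ≡⟨ eq ⟩
  g * suc b + A          ∎)))
  where open ≤-Reasoning

absurd : {X : Set α} → 1 ≤ 0 → X
absurd ()

leastBelow : ∀ {P : ℕ → Set α} → (∀ m → Dec (P m)) → ∀ N →
             (∃[ m ] (P m × (∀ q → q < m → ¬ P q))) ⊎ (∀ q → q < N → ¬ P q)
leastBelow P? zero = inj₂ λ _ ()
leastBelow {P = P} P? (suc N) with leastBelow P? N
... | inj₁ found = inj₁ found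
... | inj₂ none with P? N
...   | yes pN = inj₁ (N , pN , none)
...   | no ¬pN = inj₂ below
  where
  below : ∀ q → q < suc N → ¬ P q
  below q q<1+N with m<1+n⇒m<n∨m≡n q<1+N
  ... | inj₁ q<N  = none q q<N
  ... | inj₂ refl = ¬pN

least : ∀ {P : ℕ → Set α} → (∀ m → Dec (P m)) → ∀ {N} → P N →
        ∃[ m ] (P m × (∀ q → P q → m ≤ q))
least P? {N} pN with leastBelow P? (suc N)
... | inj₁ (m , pm , min) = m , pm , λ q pq → ≮⇒≥ λ q<m → min q q<m pq
... | inj₂ none = contradiction pN (none N ≤-refl)

-- x and y will compare the starts of two runs, and s and t their ends, relative to
-- an alignment of the text with itself.
Kind : ℕ → ℕ → ℕ → ℕ → Fin 6 → Set
Kind x y s t 0F = x ≡ y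
Kind x y s t 1F = s ≡ t
Kind x y s t 2F = y < x × s < t
Kind x y s t 3F = x < y × t < s
Kind x y s t 4F = y < x × t < s
Kind x y s t 5F = x < y × s < t

kind : ∀ x y s t → ∃ (Kind x y s t)
kind x y s t with <-cmp x y | <-cmp s t
... | tri≈ _ x≡y _ | _            = 0F , x≡y
... | _            | tri≈ _ s≡t _ = 1F , s≡t
... | tri> _ _ y<x | tri< s<t _ _ = 2F , y<x , s<t
... | tri< x<y _ _ | tri> _ _ t<s = 3F , x<y , t<s
... | tri> _ _ y<x | tri> _ _ t<s = 4F , y<x , t<s
... | tri< x<y _ _ | tri< s<t _ _ = 5F , x<y , s<t

-- Dyadic size classes and their thirds

slot : ∀ R a l → a < R * l → ∃[ q ] (toℕ {R} q * l ≤ a × a < toℕ q * l + l)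
slot (suc R) a l a< with a <? l
... | yes a<l = Fin.zero , z≤n , a<l
... | no a≮l with m≤n⇒∃[o]m+o≡n (≮⇒≥ a≮l)
...   | b , refl with slot R b l (+-cancelˡ-< l b (R * l) a<)
...     | q , ≤b , b< =
        Fin.suc q , +-monoʳ-≤ l ≤b ,
            ≤-trans (+-monoʳ-< l b<) (≤-reflexive (sym (+-assoc l (toℕ q * l) l)))

level : ∀ L e → 1 ≤ e → e < 2 ^ L → ∃[ j ] (2 ^ toℕ {L} j ≤ e × e < 2 ^ suc (toℕ j))
level zero    e 1≤e e<1 = ⊥-elim (<-irrefl refl (≤-trans e<1 1≤e))
level (suc L) e 1≤e e<  with e <? 2 ^ L
... | no e≮ = Fin.fromℕ L , subst (λ j → 2 ^ j ≤ e × e < 2 ^ suc j) (sym (Fin.toℕ-fromℕ L))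
        (≮⇒≥ e≮ , e<)
... | yes e<′ with level L e 1≤e e<′
...   | j , bounds = Fin.inject₁ j , subst (λ j → 2 ^ j ≤ e × e < 2 ^ suc j)
        (sym (Fin.toℕ-inject₁ j)) bounds

octave : ∀ {L} → Fin L × Fin 3 → ℕ
octave (j , _) = 2 ^ toℕ j

-- e is at least l = octave b, and if e < 2 l then it lies in the q-th third of it.
record InBucket {L} (b : Fin L × Fin 3) (e : ℕ) : Set where
  constructor inBucket
  field
    octave≤ : octave b ≤ e
    third≤  : toℕ (proj₂ b) * octave b + 3 * octave b ≤ 3 * e
    <third  : 3 * e < toℕ (proj₂ b) * octave b + 4 * octave b

third : ∀ {l e} → l ≤ e → e < 2 * l → ∃[ q ] (toℕ {3} q * l + 3 * l ≤ 3 * e ×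
    3 * e < toℕ q * l + 4 * l)
third {l} {e} l≤e e<2l with m≤n⇒∃[o]m+o≡n l≤e
... | y , refl with slot 3 (3 * y) l (lin 2 (e<2l ⊕ e<2l ⊕ e<2l) (solve (y ∷ l ∷ [])))
...   | q , ≤3y , 3y< = q , above ≤3y , below 3y<
  where
  above : ∀ {w} → w ≤ 3 * y → w + 3 * l ≤ 3 * (l + y)
  above {w} ≤3y = lin 0 ≤3y (solve (w ∷ l ∷ y ∷ []))
  below : ∀ {w} → 3 * y < w + l → 3 * (l + y) < w + 4 * l
  below {w} 3y< = lin 0 3y< (solve (l ∷ y ∷ w ∷ []))

bucket : ∀ {L e} → 1 ≤ e → e < 2 ^ L → ∃[ b ] (InBucket {L} b e × e < 2 * octave b)
bucket {L} {e} 1≤e e< with level L e 1≤e e<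
... | j , l≤e , e<2l with third l≤e e<2l
...   | q , lower , upper = (j , q) , inBucket l≤e lower upper , e<2l

-- A third of an octave has width `octave b / 3`, so two values in one bucket differ by less than a
-- third of either. Periods that arise as such differences are therefore short.
bucket-close : ∀ {L} (b : Fin L × Fin 3) {e e′} → InBucket b e → InBucket b e′ →
    3 * e′ < 3 * e + octave b
bucket-close b {e} {e′} i i′ =
    close {toℕ (proj₂ b) * octave b} {octave b} {e} {e′} (InBucket.third≤ i) (InBucket.<third i′)
  where
  close : ∀ {w l e e′} → w + 3 * l ≤ 3 * e → 3 * e′ < w + 4 * l → 3 * e′ < 3 * e + l
  close {w} {l} {e} {e′} lower upper = lin 0 (lower ⊕ upper) (solve (e′ ∷ e ∷ l ∷ w ∷ []))

logarithm : ∀ n → ∃[ L ] (suc n < 2 ^ L × 2 ^ L ≤ 2 * suc n)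
logarithm zero = 1 , ≤-refl , ≤-refl
logarithm (suc n) with logarithm n
... | L , n<2^L , 2^L≤2n with suc (suc n) <? 2 ^ L
...   | yes <2^L = L , <2^L , ≤-trans 2^L≤2n (*-monoʳ-≤ 2 (n≤1+n (suc n)))
...   | no ≮2^L = suc L ,
        ≤-trans (m<m*n (suc (suc n)) 2 ≤-refl) (≤-trans (≤-reflexive (*-comm (suc (suc n)) 2))
            (*-monoʳ-≤ 2 n<2^L)) ,
        *-monoʳ-≤ 2 (≮⇒≥ ≮2^L)

private
  variable
    A : Set α

-- Characters of a string by position

at : List A → ℕ → Maybe A
at xs i = head (drop i xs)

at-length : (xs : List A) → at xs (length xs) ≡ nothing
at-length []       = refl
at-length (x ∷ xs) = at-length xs

at-just : ∀ (xs : List A) {i} → i < length xs → at xs i ≢ nothing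
at-just (x ∷ xs) {zero}  _         ()
at-just (x ∷ xs) {suc i} (s≤s i<n) = at-just xs i<n

at-++ʳ : ∀ (U W : List A) t → at (U ++ W) (length U + t) ≡ at W t
at-++ʳ []      W t = refl
at-++ʳ (_ ∷ U) W t = at-++ʳ U W t

at-++ˡ : ∀ (U W : List A) {t} → t < length U → at (U ++ W) t ≡ at U t
at-++ˡ (_ ∷ U) W {zero}  _         = refl
at-++ˡ (_ ∷ U) W {suc t} (s≤s t<n) = at-++ˡ U W t<n

at-drop : ∀ (xs : List A) i t → at (drop i xs) t ≡ at xs (i + t)
at-drop xs       zero    t       = refl
at-drop []       (suc i) zero    = refl
at-drop []       (suc i) (suc t) = refl
at-drop (x ∷ xs) (suc i) t       = at-drop xs i t

-- LZ77 phrases and their earlier occurrences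

concat-split : (Fs : List (List A)) (i : Fin (length Fs)) →
  concat Fs ≡ concat (take (toℕ i) Fs) ++ lookup Fs i ++ concat (drop (suc (toℕ i)) Fs)
concat-split (F ∷ Fs) Fin.zero    = refl
concat-split (F ∷ Fs) (Fin.suc i) = trans (cong (F ++_) (concat-split Fs i)) (sym (++-assoc F _ _))

length-take-suc : (Fs : List (List A)) (i : Fin (length Fs)) →
  length (concat (take (suc (toℕ i)) Fs)) ≡ length (concat (take (toℕ i) Fs)) + length (lookup Fs i)
length-take-suc (F ∷ Fs) Fin.zero    = trans (length-++ F) (+-comm (length F) 0)
length-take-suc (F ∷ Fs) (Fin.suc i) = begin
  length (F ++ concat (take (suc (toℕ i)) Fs))                        ≡⟨ length-++ F ⟩
  length F + length (concat (take (suc (toℕ i)) Fs))                  ≡⟨ cong (length F +_)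
      (length-take-suc Fs i) ⟩
  length F + (length (concat (take (toℕ i) Fs)) + length (lookup Fs i))  ≡⟨ +-assoc (length F) _ _ ⟨
  length F + length (concat (take (toℕ i) Fs)) + length (lookup Fs i)    ≡⟨ cong
      (_+ length (lookup Fs i)) (length-++ F) ⟨
  length (F ++ concat (take (toℕ i) Fs)) + length (lookup Fs i)          ∎
  where open ≡-Reasoning

-- An occurrence of `F` in `P ++ F` has offset at most `length P`, so of two distinct offsets one is
-- smaller than `length P`.
earlier-occurrence : ∀ {P R F : List A} → IsLongestRepeat P R F →
  ∃[ U ] ∃[ V ] (P ++ F ≡ U ++ F ++ V × length U < length P)
earlier-occurrence {P = P} {F = F} (_ , _ , (p , q , p≢q , (U , V , eqU , lenU) ,
    (U′ , V′ , eqU′ , lenU′)) , _)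
  with length U <? length P | length U′ <? length P
... | yes lt | _      = U , V , eqU , lt
... | no _   | yes lt = U′ , V′ , eqU′ , lt
... | no ≮   | no ≮′  =
        contradiction (trans (sym lenU) (trans (trans (here U V eqU ≮) (sym (here U′ V′ eqU′ ≮′)))
            lenU′)) p≢q
  where
  here : ∀ U V → P ++ F ≡ U ++ F ++ V → ¬ length U < length P → length U ≡ length P
  here U V eq ≮ = bound (length P) (length F) (length U) (length V) (begin
    length P + length F               ≡⟨ length-++ P ⟨
    length (P ++ F)                   ≡⟨ cong length eq ⟩
    length (U ++ F ++ V)              ≡⟨ length-++ U ⟩
    length U + length (F ++ V)        ≡⟨ cong (length U +_) (length-++ F) ⟩
    length U + (length F + length V)  ∎) (≮⇒≥ ≮)
    where
    open ≡-Reasoning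
    bound : ∀ a f u v → a + f ≡ u + (f + v) → a ≤ u → u ≡ a
    bound a f u v eq a≤u =
        ≤-antisym (lin v (≤-reflexive (sym eq)) (solve (u ∷ a ∷ f ∷ v ∷ [])))
            (lin 0 a≤u (solve (a ∷ u ∷ [])))

module Phrases {A : Set α} (S : List A) (Fs : List (List A)) (lz : IsLZ77 S Fs) where
  start : ℕ → ℕ
  start j = suc (length (concat (take j Fs)))

  take-all : (Gs : List (List A)) → take (length Gs) Gs ≡ Gs
  take-all []       = refl
  take-all (G ∷ Gs) = cong (G ∷_) (take-all Gs)

  start-last : start (length Fs) ≡ suc (length S)
  start-last = cong suc (cong length (trans (cong concat (take-all Fs)) (sym (proj₁ lz))))

  start-suc : ∀ i → start (suc (toℕ i)) ≡ start (toℕ i) + length (lookup Fs i)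
  start-suc i = cong suc (length-take-suc Fs i)

  -- The window is T[s .. s + m], and a phrase start must lie in it but not at its first position.
  -- The index `j` takes z + 1 values: the last start is the position of the closing sentinel.
  Crosses : ℕ → ℕ → Set
  Crosses s m = ∃[ j ] (s < start (toℕ {suc (length Fs)} j) × start (toℕ j) ≤ s + m)

  Inside : ℕ → ℕ → Set
  Inside s m = ∃[ i ] (start (toℕ {length Fs} i) ≤ s × s + m < start (suc (toℕ i)))

  crosses-or-inside : ∀ {s m} → 1 ≤ m → s + m ≤ suc (length S) → Crosses s m ⊎ Inside s m
  crosses-or-inside {s} {m} 1≤m fits with s <? 1
  -- Position 0 holds the sentinel, just before the first phrase, so a window from there crosses the
  -- first phrase start.
  ... | yes s<1 = inj₁ (Fin.zero , s<1 , ≤-trans 1≤m (m≤n+m m s))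
  ... | no s≮1  = go (length Fs) 0 (+-identityʳ (length Fs)) (≮⇒≥ s≮1)
    where
    go : ∀ d j → d + j ≡ length Fs → start j ≤ s → Crosses s m ⊎ Inside s m
    go zero j refl ≤s = ⊥-elim
        (<-irrefl refl (≤-trans (m<m+n s 1≤m) (≤-trans fits (≤-trans (≤-reflexive (sym start-last))
                ≤s))))
    go (suc d) j d+j≡ ≤s with start (suc j) ≤? s
    ... | yes ≤s′ = go d (suc j) (trans (+-suc d j) d+j≡) ≤s′
    ... | no ≰s with start (suc j) ≤? s + m
    ...   | yes ≤s+m = inj₁ (fromℕ< (s≤s j<z) , subst (s <_) (sym eq) (≰⇒> ≰s) ,
            subst (_≤ s + m) (sym eq) ≤s+m)
      where
      j<z : suc j ≤ length Fs
      j<z = ≤-trans (s≤s (m≤n+m j d)) (≤-reflexive d+j≡)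
      eq : start (toℕ (fromℕ< (s≤s j<z))) ≡ start (suc j)
      eq = cong start (Fin.toℕ-fromℕ< (s≤s j<z))
    ...   | no ≰s+m = inj₂ (fromℕ< j<z , subst (λ i → start i ≤ s) (sym eq) ≤s ,
            subst (λ i → s + m < start (suc i)) (sym eq) (≰⇒> ≰s+m))
      where
      j<z : suc j ≤ length Fs
      j<z = ≤-trans (s≤s (m≤n+m j d)) (≤-reflexive d+j≡)
      eq : toℕ (fromℕ< j<z) ≡ j
      eq = Fin.toℕ-fromℕ< j<z

  source : ∀ {s m} → 1 ≤ m → Inside s m →
           ∃[ s′ ] (s′ < s × (∀ t → t < suc m → S ⟦ s′ + t ⟧ ≡ S ⟦ s + t ⟧))
  source {s} {m} 1≤m (i , ≤s , s+m<) with m≤n⇒∃[o]m+o≡n ≤s | proj₂ lz i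
  -- A phrase of length 1 has no room for a window of `suc m` ≥ 2 characters.
  ... | t , refl | inj₁ (c , F≡[c] , _) =
          absurd′ _ t m (≤-trans s+m<
              (≤-reflexive (trans (start-suc i) (cong (start (toℕ i) +_) (cong length F≡[c]))))) 1≤m
    where
    absurd′ : ∀ a t m {X : Set α} → a + t + m < a + 1 → 1 ≤ m → X
    absurd′ a t m lt 1≤m = absurd (lin t (lt ⊕ 1≤m) (solve (a ∷ t ∷ m ∷ [])))
  ... | t , refl | inj₂ repeat with earlier-occurrence repeat
  -- The offset `t` within the phrase is kept, and only the phrase is replaced by its earlier
  -- occurrence, which may overlap it.
  ...   | U , V , eq , U<P = suc (length U + t) , s≤s (+-monoˡ-< t U<P) , λ r r≤m → begin
      at S (length U + t + r)                ≡⟨ cong (at S) (+-assoc (length U) t r) ⟩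
      at S (length U + (t + r))              ≡⟨ cong (λ W → at W (length U + (t + r))) S≡′ ⟩
      at (U ++ F ++ V ++ W) (length U + (t + r))  ≡⟨ at-++ʳ U _ (t + r) ⟩
      at (F ++ V ++ W) (t + r)               ≡⟨ at-++ˡ F _ (t+r< r≤m) ⟩
      at F (t + r)                           ≡⟨ at-++ˡ F W (t+r< r≤m) ⟨
      at (F ++ W) (t + r)                    ≡⟨ at-++ʳ P _ (t + r) ⟨
      at (P ++ F ++ W) (length P + (t + r))  ≡⟨ cong (λ W → at W (length P + (t + r))) S≡ ⟨
      at S (length P + (t + r))              ≡⟨ cong (at S) (+-assoc (length P) t r) ⟨
      at S (length P + t + r)                ∎
    where
    open ≡-Reasoning
    P = concat (take (toℕ i) Fs)
    F = lookup Fs i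
    W = concat (drop (suc (toℕ i)) Fs)
    S≡ : S ≡ P ++ F ++ W
    S≡ = trans (proj₁ lz) (concat-split Fs i)
    S≡′ : S ≡ U ++ F ++ V ++ W
    S≡′ = trans S≡ (trans (sym (++-assoc P F W)) (trans (cong (_++ W) eq)
            (trans (++-assoc U (F ++ V) W) (cong (U ++_) (++-assoc F V W)))))
    bound : ∀ {a f t m r} → suc a + t + m < suc a + f → r < suc m → t + r < f
    bound {a} {f} {t} {m} {r} lt r≤m = lin 0 (lt ⊕ r≤m) (solve (t ∷ r ∷ f ∷ a ∷ m ∷ []))
    t+r< : ∀ {r} → r < suc m → t + r < length F
    t+r< {r} r≤m = bound {length P} {length F} {t} {m} {r}
        (≤-trans s+m< (≤-reflexive (start-suc i))) r≤m

  -- Following the sources of the phrases to the left ends at an occurrence that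
  -- is not inside a phrase.
  crossing : ∀ s m → 1 ≤ m → s + m ≤ suc (length S) →
    ∃[ s′ ] ((∀ t → t < suc m → S ⟦ s′ + t ⟧ ≡ S ⟦ s + t ⟧) × s′ + m ≤ suc (length S) ×
        Crosses s′ m)
  crossing s m 1≤m fits = go (suc s) s ≤-refl fits
    where
    go : ∀ d s → s < d → s + m ≤ suc (length S) →
      ∃[ s′ ] ((∀ t → t < suc m → S ⟦ s′ + t ⟧ ≡ S ⟦ s + t ⟧) × s′ + m ≤ suc (length S) ×
          Crosses s′ m)
    go (suc d) s (s≤s s≤d) fits with crosses-or-inside 1≤m fits
    ... | inj₁ crosses = s , (λ _ _ → refl) , fits , crosses
    ... | inj₂ inside with source 1≤m inside
    ...   | s′ , s′<s , copy with go d s′ (≤-trans s′<s s≤d) (≤-trans (+-monoˡ-≤ m (<⇒≤ s′<s)) fits)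
    ...     | s″ , copy′ , fits″ , crosses =
            s″ , (λ t t≤m → trans (copy′ t t≤m) (copy t t≤m)) , fits″ , crosses

-- Comparison of rotations, changes in a sequence, and finite codes

-- The two sentinels sit at different offsets, so the comparison is decided at the first of them at
-- the latest; there `at` returns `nothing` on the shorter list, which is again the sentinel.
lex⇒branch : ∀ {_≺_ : Rel (Maybe A) ℓ} (xs ys : List A) {xs′ ys′} → length xs ≢ length ys →
  Lex-< _≡_ _≺_ (map just xs ++ nothing ∷ xs′) (map just ys ++ nothing ∷ ys′) →
  ∃[ k ] (k ≤ length xs × k ≤ length ys × (∀ t → t < k → at xs t ≡ at ys t) × (at xs k ≺ at ys k))
lex⇒branch []       []       len≢ _            = contradiction refl len≢
lex⇒branch []       (y ∷ ys) _    (this lt)    = 0 , z≤n , z≤n , (λ _ ()) , lt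
lex⇒branch (x ∷ xs) []       _    (this lt)    = 0 , z≤n , z≤n , (λ _ ()) , lt
lex⇒branch (x ∷ xs) (y ∷ ys) _    (this lt)    = 0 , z≤n , z≤n , (λ _ ()) , lt
lex⇒branch (x ∷ xs) (y ∷ ys) len≢ (next eq lt) with lex⇒branch xs ys (len≢ ∘ cong suc) lt
... | k , k≤ , k≤′ , copy , branch = suc k , s≤s k≤ , s≤s k≤′ , copy′ , branch
  where
  copy′ : ∀ t → t < suc k → at (x ∷ xs) t ≡ at (y ∷ ys) t
  copy′ zero    _         = eq
  copy′ (suc t) (s≤s t<k) = copy t t<k

-- Every run but the first begins at a change. Listing the changes by an injection `h` reduces a
-- bound on their number to the injectivity of a code.
derun-changes : ∀ (_≟_ : DecidableEquality A) {n} (f : Fin (suc n) → A) →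
  ∃[ m ] Σ (Fin m → Fin n) λ h → Injective _≡_ _≡_ h ×
    (∀ i → f (Fin.inject₁ (h i)) ≢ f (Fin.suc (h i))) × length (derun _≟_ (tabulate f)) ≡ suc m
derun-changes _≟_ {zero}  f = 0 , (λ ()) , (λ { {()} }) , (λ ()) , refl
derun-changes _≟_ {suc n} f with f Fin.zero ≟ f (Fin.suc Fin.zero) | derun-changes _≟_ (f ∘ Fin.suc)
... | yes _ | m , h , inj , change , len = m , Fin.suc ∘ h , inj ∘ Fin.suc-injective , change , len
... | no f₀≢f₁ | m , h , inj , change , len = suc m , h′ , inj′ , change′ , cong suc len
  where
  h′ : Fin (suc m) → Fin (suc n)
  h′ Fin.zero    = Fin.zero
  h′ (Fin.suc i) = Fin.suc (h i)
  inj′ : Injective _≡_ _≡_ h′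
  inj′ {Fin.zero}  {Fin.zero}  _  = refl
  inj′ {Fin.suc i} {Fin.suc j} eq = cong Fin.suc (inj (Fin.suc-injective eq))
  change′ : ∀ i → f (Fin.inject₁ (h′ i)) ≢ f (Fin.suc (h′ i))
  change′ Fin.zero    = f₀≢f₁
  change′ (Fin.suc i) = change i

infixr 6 _⊞_
_⊞_ : ∀ {m n} {X Y : Set} → Fin m ↔ X → Fin n ↔ Y → Fin (m + n) ↔ (X ⊎ Y)
x ⊞ y = (x ⊎-↔ y) ↔-∘ Fin.+↔⊎

infixr 7 _⊠_
_⊠_ : ∀ {m n} {X Y : Set} → Fin m ↔ X → Fin n ↔ Y → Fin (m * n) ↔ (X × Y)
x ⊠ y = (x ×-↔ y) ↔-∘ Fin.*↔×

from-injective : ∀ {m} {X : Set} (x : Fin m ↔ X) {a b} → Inverse.from x a ≡ Inverse.from x b → a ≡ b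
from-injective x {a} {b} eq =
    trans (sym (Inverse.strictlyInverseˡ x a)) (trans (cong (Inverse.to x) eq)
        (Inverse.strictlyInverseˡ x b))

-- Linear inequalities between positions, periods and shifts

s+p≤1+n⇒p≤1+n : ∀ s p n → s + p ≤ suc n → p ≤ suc n
s+p≤1+n⇒p≤1+n s p n h₁ = lin s h₁ (solve (p ∷ n ∷ s ∷ []))

s+p≤1+n∧1≤s∧p+y≡1+n⇒1≤y : ∀ s p n y → s + p ≤ suc n → 1 ≤ s → p + y ≡ suc n → 1 ≤ y
s+p≤1+n∧1≤s∧p+y≡1+n⇒1≤y s p n y h₁ h₂ h₃ =
    lin 0 (h₁ ⊕ h₂ ⊕ ≤-reflexive (sym h₃)) (solve (y ∷ s ∷ p ∷ n ∷ []))

p+y≡1+n∧1≤p⇒y≤n : ∀ p y n → p + y ≡ suc n → 1 ≤ p → y ≤ n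
p+y≡1+n∧1≤p⇒y≤n p y n h₁ h₂ = lin 0 (≤-reflexive h₁ ⊕ h₂) (solve (y ∷ n ∷ p ∷ []))

s+p≤1+n∧p+y≡1+n⇒s≤y : ∀ s p n y → s + p ≤ suc n → p + y ≡ suc n → s ≤ y
s+p≤1+n∧p+y≡1+n⇒s≤y s p n y h₁ h₂ = lin 0 (h₁ ⊕ ≤-reflexive (sym h₂)) (solve (s ∷ y ∷ p ∷ n ∷ []))

p+y≡1+n∧1+n<e⇒y+p<e : ∀ p y n e → p + y ≡ suc n → suc n < e → y + p < e
p+y≡1+n∧1+n<e⇒y+p<e p y n e h₁ h₂ = lin 0 (≤-reflexive h₁ ⊕ h₂) (solve (y ∷ p ∷ e ∷ n ∷ []))

u+k≤n∧3*p≤m+p∧m≤k⇒1+u+p≤1+n : ∀ u k n p m → u + k ≤ n → 3 * p ≤ m + p → m ≤ k → suc u + p ≤ suc n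
u+k≤n∧3*p≤m+p∧m≤k⇒1+u+p≤1+n u k n p m h₁ h₂ h₃ =
    lin p (h₁ ⊕ h₂ ⊕ h₃) (solve (u ∷ p ∷ n ∷ k ∷ m ∷ []))

1+n<u+1+[m+p]⇒1+n<1+u+[m+p] : ∀ n u m p → suc n < u + suc (m + p) → suc n < suc u + (m + p)
1+n<u+1+[m+p]⇒1+n<1+u+[m+p] n u m p h₁ = lin 0 h₁ (solve (n ∷ u ∷ m ∷ p ∷ []))

3*p≤k⇒p≤1+k+j : ∀ p k j → 3 * p ≤ k → p ≤ suc k + j
3*p≤k⇒p≤1+k+j p k j h₁ = lin (1 + j + 2 * p) h₁ (solve (p ∷ k ∷ j ∷ []))

3*p≤k⇒p<1+k : ∀ p k → 3 * p ≤ k → p < suc k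
3*p≤k⇒p<1+k p k h₁ = lin (2 * p) h₁ (solve (p ∷ k ∷ []))

p+m≡1+k+j⇒k<m+p : ∀ p m k j → p + m ≡ suc k + j → k < m + p
p+m≡1+k+j⇒k<m+p p m k j h₁ = lin j (≤-reflexive (sym h₁)) (solve (k ∷ m ∷ p ∷ j ∷ []))

3*p≤k∧p+m≡1+k+j⇒3*p≤m+p : ∀ p k m j → 3 * p ≤ k → p + m ≡ suc k + j → 3 * p ≤ m + p
3*p≤k∧p+m≡1+k+j⇒3*p≤m+p p k m j h₁ h₂ =
    lin (1 + j) (h₁ ⊕ ≤-reflexive (sym h₂)) (solve (p ∷ m ∷ k ∷ j ∷ []))

p+m≡1+k+j∧j<p⇒m≤k : ∀ p m k j → p + m ≡ suc k + j → j < p → m ≤ k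
p+m≡1+k+j∧j<p⇒m≤k p m k j h₁ h₂ = lin 0 (≤-reflexive h₁ ⊕ h₂) (solve (m ∷ k ∷ p ∷ j ∷ []))

new-position≡ : ∀ y p u k j m → y + p < suc u + (suc k + suc j) → suc u + (suc k + j) ≤ y + p →
    p + m ≡ suc k + j → y ≡ suc u + m
new-position≡ y p u k j m h₁ h₂ h₃ =
    ≤-antisym (lin 0 (h₁ ⊕ ≤-reflexive (sym h₃)) (solve (y ∷ u ∷ m ∷ p ∷ k ∷ j ∷ [])))
        (lin 0 (h₂ ⊕ ≤-reflexive h₃) (solve (u ∷ m ∷ y ∷ k ∷ j ∷ p ∷ [])))

y₂+p+d≡y₂+d+p : ∀ y₂ p d → y₂ + p + d ≡ y₂ + d + p
y₂+p+d≡y₂+d+p y₂ p d = solve (y₂ ∷ p ∷ d ∷ [])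

3*p≤k⇒p≤k : ∀ p k → 3 * p ≤ k → p ≤ k
3*p≤k⇒p≤k p k h₁ = lin (2 * p) h₁ (solve (p ∷ k ∷ []))

1+[y₂+d]+[k+p]≤1+[y₂+p+d]+k : ∀ y₂ d k p → suc (y₂ + d) + (k + p) ≤ suc (y₂ + p + d) + k
1+[y₂+d]+[k+p]≤1+[y₂+p+d]+k y₂ d k p = lin 0 (z≤n {0}) (solve (y₂ ∷ d ∷ k ∷ p ∷ []))

3*p≤k⇒p<1+[1+k] : ∀ p k → 3 * p ≤ k → p < suc (suc k)
3*p≤k⇒p<1+[1+k] p k h₁ = lin (1 + 2 * p) h₁ (solve (p ∷ k ∷ []))

y₂+p+d+k≤n⇒y₂+d≤n : ∀ y₂ p d k n → y₂ + p + d + k ≤ n → y₂ + d ≤ n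
y₂+p+d+k≤n⇒y₂+d≤n y₂ p d k n h₁ = lin (k + p) h₁ (solve (y₂ ∷ d ∷ n ∷ p ∷ k ∷ []))

t<p∧p≤k⇒a+t+p<a+[k+p] : ∀ t p k a → t < p → p ≤ k → a + t + p < a + (k + p)
t<p∧p≤k⇒a+t+p<a+[k+p] t p k a h₁ h₂ = lin 0 (h₁ ⊕ h₂) (solve (a ∷ t ∷ p ∷ k ∷ []))

1+u+[k+p]≤1+u+[1+k+p] : ∀ u k p → suc u + (k + p) ≤ suc u + (suc k + p)
1+u+[k+p]≤1+u+[1+k+p] u k p = lin 1 (z≤n {0}) (solve (u ∷ k ∷ p ∷ []))

1+u+k+p<1+u+[1+k+p] : ∀ u k p → suc u + k + p < suc u + (suc k + p)
1+u+k+p<1+u+[1+k+p] u k p = lin 0 (z≤n {0}) (solve (u ∷ k ∷ p ∷ []))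

1≤a∧a≤s∧s+p≤a+e∧a+e≤1+n⇒p≤n : ∀ a s p e n → 1 ≤ a → a ≤ s → s + p ≤ a + e → a + e ≤ suc n → p ≤ n
1≤a∧a≤s∧s+p≤a+e∧a+e≤1+n⇒p≤n a s p e n h₁ h₂ h₃ h₄ =
    lin 0 (h₁ ⊕ h₂ ⊕ h₃ ⊕ h₄) (solve (p ∷ n ∷ a ∷ s ∷ e ∷ []))

1≤a∧a≤s∧s+p≤a+e∧a+e≤g+p⇒p<g+p : ∀ a s p e g → 1 ≤ a → a ≤ s → s + p ≤ a + e → a + e ≤ g + p →
    p < g + p
1≤a∧a≤s∧s+p≤a+e∧a+e≤g+p⇒p<g+p a s p e g h₁ h₂ h₃ h₄ =
    lin 0 (h₁ ⊕ h₂ ⊕ h₃ ⊕ h₄) (solve (p ∷ g ∷ a ∷ s ∷ e ∷ []))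

1+y≤s∧s+p≤a+e∧a+e≤1+n⇒1+y+p≤1+n : ∀ y s p a e n → suc y ≤ s → s + p ≤ a + e → a + e ≤ suc n →
    suc y + p ≤ suc n
1+y≤s∧s+p≤a+e∧a+e≤1+n⇒1+y+p≤1+n y s p a e n h₁ h₂ h₃ =
    lin 0 (h₁ ⊕ h₂ ⊕ h₃) (solve (y ∷ p ∷ n ∷ s ∷ a ∷ e ∷ []))

1+n≤g∧1≤p⇒1+n<g+p : ∀ n g p → suc n ≤ g → 1 ≤ p → suc n < g + p
1+n≤g∧1≤p⇒1+n<g+p n g p h₁ h₂ = lin 0 (h₁ ⊕ h₂) (solve (n ∷ g ∷ p ∷ []))

p≤e⇒p≤g+e : ∀ p e g → p ≤ e → p ≤ g + e
p≤e⇒p≤g+e p e g h₁ = lin g h₁ (solve (p ∷ g ∷ e ∷ []))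

ε≤g₂+p∧β′+e≤ε∧1+V+g≡β′⇒1+V+[g+e]≤g₂+p : ∀ ε g₂ p β′ e V g → ε ≤ g₂ + p → β′ + e ≤ ε →
    suc V + g ≡ β′ → suc V + (g + e) ≤ g₂ + p
ε≤g₂+p∧β′+e≤ε∧1+V+g≡β′⇒1+V+[g+e]≤g₂+p ε g₂ p β′ e V g h₁ h₂ h₃ =
    lin 0 (h₁ ⊕ h₂ ⊕ ≤-reflexive h₃) (solve (V ∷ g ∷ e ∷ g₂ ∷ p ∷ ε ∷ β′ ∷ []))

p≤e∧g+e≤k⇒g+p≤k : ∀ p e g k → p ≤ e → g + e ≤ k → g + p ≤ k
p≤e∧g+e≤k⇒g+p≤k p e g k h₁ h₂ = lin 0 (h₁ ⊕ h₂) (solve (g ∷ p ∷ k ∷ e ∷ []))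

1+y₁≤a∧a+e≤β∧1+U+[g+e]≡β⇒1+y₁≤1+U+g : ∀ y₁ a e β U g → suc y₁ ≤ a → a + e ≤ β →
    suc U + (g + e) ≡ β → suc y₁ ≤ suc U + g
1+y₁≤a∧a+e≤β∧1+U+[g+e]≡β⇒1+y₁≤1+U+g y₁ a e β U g h₁ h₂ h₃ =
    lin 0 (h₁ ⊕ h₂ ⊕ ≤-reflexive (sym h₃)) (solve (y₁ ∷ U ∷ g ∷ a ∷ e ∷ β ∷ []))

1+y₁≤a∧a+p≤β∧1+U+[g+e]≡β⇒1+y₁+p≤1+U+[g+e] : ∀ y₁ a p β U g e → suc y₁ ≤ a → a + p ≤ β →
    suc U + (g + e) ≡ β → suc y₁ + p ≤ suc U + (g + e)
1+y₁≤a∧a+p≤β∧1+U+[g+e]≡β⇒1+y₁+p≤1+U+[g+e] y₁ a p β U g e h₁ h₂ h₃ =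
    lin 0 (h₁ ⊕ h₂ ⊕ ≤-reflexive (sym h₃)) (solve (y₁ ∷ p ∷ U ∷ g ∷ e ∷ a ∷ β ∷ []))

start₂-before-start₁ : ∀ y₂ β y₁ β′ e U g V → suc y₂ + β < suc y₁ + (β′ + e) → suc U + (g + e) ≡ β →
    suc V + g ≡ β′ → suc y₂ + suc U < suc y₁ + suc V
start₂-before-start₁ y₂ β y₁ β′ e U g V h₁ h₂ h₃ =
    lin 0 (h₁ ⊕ ≤-reflexive h₂ ⊕ ≤-reflexive (sym h₃))
        (solve (y₂ ∷ U ∷ y₁ ∷ V ∷ β ∷ β′ ∷ e ∷ g ∷ []))

1+y₂≤β′∧p≤e∧1+V+g≡β′⇒1+y₂+p≤1+V+[g+e] : ∀ y₂ β′ p e V g → suc y₂ ≤ β′ → p ≤ e → suc V + g ≡ β′ →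
    suc y₂ + p ≤ suc V + (g + e)
1+y₂≤β′∧p≤e∧1+V+g≡β′⇒1+y₂+p≤1+V+[g+e] y₂ β′ p e V g h₁ h₂ h₃ =
    lin 0 (h₁ ⊕ h₂ ⊕ ≤-reflexive (sym h₃)) (solve (y₂ ∷ p ∷ V ∷ g ∷ e ∷ β′ ∷ []))

start₁-before-start₂ : ∀ y₁ β′ e y₂ β U g V → suc y₁ + (β′ + e) < suc y₂ + β → suc U + (g + e) ≡ β →
    suc V + g ≡ β′ → suc y₁ + suc V < suc y₂ + suc U
start₁-before-start₂ y₁ β′ e y₂ β U g V h₁ h₂ h₃ =
    lin 0 (h₁ ⊕ ≤-reflexive (sym h₂) ⊕ ≤-reflexive h₃)
        (solve (y₁ ∷ V ∷ y₂ ∷ U ∷ β′ ∷ e ∷ β ∷ g ∷ []))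

1+U+[g+e]≤g₁+p∧p≤e⇒1+U+g+p≤g₁+p : ∀ U g e g₁ p → suc U + (g + e) ≤ g₁ + p → p ≤ e →
    suc U + g + p ≤ g₁ + p
1+U+[g+e]≤g₁+p∧p≤e⇒1+U+g+p≤g₁+p U g e g₁ p h₁ h₂ = lin 0 (h₁ ⊕ h₂) (solve (U ∷ g ∷ p ∷ g₁ ∷ e ∷ []))

end₁-before-end₂ : ∀ g₁ p β′ e g₂ β U g V → g₁ + p + (β′ + e) < g₂ + p + β → suc U + (g + e) ≡ β →
    suc V + g ≡ β′ → g₁ + p + suc V < g₂ + p + suc U
end₁-before-end₂ g₁ p β′ e g₂ β U g V h₁ h₂ h₃ =
    lin 0 (h₁ ⊕ ≤-reflexive (sym h₂) ⊕ ≤-reflexive h₃)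
        (solve (g₁ ∷ p ∷ V ∷ g₂ ∷ U ∷ β′ ∷ e ∷ β ∷ g ∷ []))

end₂-before-end₁ : ∀ g₂ p β g₁ β′ e U g V → g₂ + p + β < g₁ + p + (β′ + e) → suc U + (g + e) ≡ β →
    suc V + g ≡ β′ → g₂ + p + suc U < g₁ + p + suc V
end₂-before-end₁ g₂ p β g₁ β′ e U g V h₁ h₂ h₃ =
    lin 0 (h₁ ⊕ ≤-reflexive h₂ ⊕ ≤-reflexive (sym h₃))
        (solve (g₂ ∷ p ∷ U ∷ g₁ ∷ V ∷ β ∷ β′ ∷ e ∷ g ∷ []))

1+U+[g+e]≡1+[1+U+t]+[g′+e]∧g+e≤k⇒t<k : ∀ U g e t g′ k →
    suc U + (g + e) ≡ suc (suc U + t) + (g′ + e) → g + e ≤ k → t < k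
1+U+[g+e]≡1+[1+U+t]+[g′+e]∧g+e≤k⇒t<k U g e t g′ k h₁ h₂ =
    lin (e + g′) (≤-reflexive (sym h₁) ⊕ h₂) (solve (t ∷ k ∷ U ∷ g ∷ e ∷ g′ ∷ []))

same-offset : ∀ U g e t g′ V V′ → suc U + (g + e) ≡ suc (suc U + t) + (g′ + e) →
    suc V + g ≡ suc V′ + g′ → suc V + t ≡ V′
same-offset U g e t g′ V V′ h₁ h₂ =
    ≤-antisym (lin 0 (≤-reflexive (sym h₁) ⊕ ≤-reflexive h₂)
        (solve (V ∷ t ∷ V′ ∷ U ∷ g ∷ e ∷ g′ ∷ []))) (lin 0 (≤-reflexive h₁ ⊕ ≤-reflexive (sym h₂))
                (solve (V′ ∷ V ∷ t ∷ U ∷ g ∷ e ∷ g′ ∷ [])))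

1+U+[g+e]≡1+U+[g′+e]∧1+V+g≡1+V′+g′⇒V≤V′ : ∀ U g e g′ V V′ → suc U + (g + e) ≡ suc U + (g′ + e) →
    suc V + g ≡ suc V′ + g′ → V ≤ V′
1+U+[g+e]≡1+U+[g′+e]∧1+V+g≡1+V′+g′⇒V≤V′ U g e g′ V V′ h₁ h₂ =
    lin 0 (≤-reflexive (sym h₁) ⊕ ≤-reflexive h₂) (solve (V ∷ V′ ∷ U ∷ g ∷ e ∷ g′ ∷ []))

1+U+[g+e]≡1+U+[g′+e]∧1+V+g≡1+V′+g′⇒V′≤V : ∀ U g e g′ V V′ → suc U + (g + e) ≡ suc U + (g′ + e) →
    suc V + g ≡ suc V′ + g′ → V′ ≤ V
1+U+[g+e]≡1+U+[g′+e]∧1+V+g≡1+V′+g′⇒V′≤V U g e g′ V V′ h₁ h₂ =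
    lin 0 (≤-reflexive h₁ ⊕ ≤-reflexive (sym h₂)) (solve (V′ ∷ V ∷ U ∷ g ∷ e ∷ g′ ∷ []))

t<e⇒t<1+e+d : ∀ t e d → t < e → t < suc e + d
t<e⇒t<1+e+d t e d h₁ = lin (1 + d) h₁ (solve (t ∷ e ∷ d ∷ []))

a′+1+d+t≡a′+t+1+d : ∀ a′ d t → a′ + suc d + t ≡ a′ + t + suc d
a′+1+d+t≡a′+t+1+d a′ d t = solve (a′ ∷ d ∷ t ∷ [])

a′+t+1+d<a′+[1+e+d]⇒t<e : ∀ a′ t d e → a′ + t + suc d < a′ + (suc e + d) → t < e
a′+t+1+d<a′+[1+e+d]⇒t<e a′ t d e h₁ = lin 0 h₁ (solve (t ∷ e ∷ a′ ∷ d ∷ []))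

l≤e∧1+U+[g+e]≡β⇒l≤β : ∀ l e U g β → l ≤ e → suc U + (g + e) ≡ β → l ≤ β
l≤e∧1+U+[g+e]≡β⇒l≤β l e U g β h₁ h₂ =
    lin (1 + U + g) (h₁ ⊕ ≤-reflexive h₂) (solve (l ∷ β ∷ e ∷ U ∷ g ∷ []))

anchors-differ-by : ∀ U g e β U′ g′ d → suc U + (g + e) ≡ β → suc U′ + (g′ + (suc e + d)) ≡ β →
    suc U + g ≡ suc U′ + g′ + suc d
anchors-differ-by U g e β U′ g′ d h₁ h₂ =
    ≤-antisym (lin 0 (≤-reflexive h₁ ⊕ ≤-reflexive (sym h₂))
        (solve (U ∷ g ∷ U′ ∷ g′ ∷ d ∷ e ∷ β ∷ []))) (lin 0 (≤-reflexive (sym h₁) ⊕ ≤-reflexive h₂)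
                (solve (U′ ∷ g′ ∷ d ∷ U ∷ g ∷ e ∷ β ∷ [])))

s+l≡β∧1+U′+[g′+[1+e+d]]≡β∧l≤e⇒1+U′+g′≤s : ∀ s l β U′ g′ e d → s + l ≡ β →
    suc U′ + (g′ + (suc e + d)) ≡ β → l ≤ e → suc U′ + g′ ≤ s
s+l≡β∧1+U′+[g′+[1+e+d]]≡β∧l≤e⇒1+U′+g′≤s s l β U′ g′ e d h₁ h₂ h₃ =
    lin (1 + d) (≤-reflexive (sym h₁) ⊕ ≤-reflexive h₂ ⊕ h₃)
        (solve (U′ ∷ g′ ∷ s ∷ l ∷ β ∷ e ∷ d ∷ []))

p≤1+d⇒p+e≤1+e+d : ∀ p d e → p ≤ suc d → p + e ≤ suc e + d
p≤1+d⇒p+e≤1+e+d p d e h₁ = lin 0 h₁ (solve (p ∷ e ∷ d ∷ []))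

p≤1+d∧3*[1+e+d]<3*e+l⇒p≤l : ∀ p d e l → p ≤ suc d → 3 * (suc e + d) < 3 * e + l → p ≤ l
p≤1+d∧3*[1+e+d]<3*e+l⇒p≤l p d e l h₁ h₂ = lin (3 + 2 * d) (h₁ ⊕ h₂) (solve (p ∷ l ∷ d ∷ e ∷ []))

-- Here `suc d` is the difference of two shifts in one bucket, hence below `l / 3`. As `p ≤ suc d`,
-- both periods together fit into the last `l` characters before `β`.
s+l≡β∧p≤1+d∧3*[1+e+d]<3*e+l⇒s+1+d+p≤β : ∀ s l β p d e → s + l ≡ β → p ≤ suc d →
    3 * (suc e + d) < 3 * e + l → s + suc d + p ≤ β
s+l≡β∧p≤1+d∧3*[1+e+d]<3*e+l⇒s+1+d+p≤β s l β p d e h₁ h₂ h₃ =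
    lin (2 + d) (≤-reflexive h₁ ⊕ h₂ ⊕ h₃) (solve (s ∷ d ∷ p ∷ β ∷ l ∷ e ∷ []))

β≤1+length : ∀ U′ g′ e d β k′ n → suc U′ + (g′ + (suc e + d)) ≡ β → g′ + (suc e + d) ≤ k′ →
    U′ + k′ ≤ n → β ≤ suc n
β≤1+length U′ g′ e d β k′ n h₁ h₂ h₃ =
    lin 0 (≤-reflexive (sym h₁) ⊕ h₂ ⊕ h₃) (solve (β ∷ n ∷ U′ ∷ g′ ∷ e ∷ d ∷ k′ ∷ []))

β′+e≤1+length : ∀ V′ g′ β′ e d k′ n → suc V′ + g′ ≡ β′ → g′ + (suc e + d) ≤ k′ → V′ + k′ ≤ n →
    β′ + (suc e + d) ≤ suc n
β′+e≤1+length V′ g′ β′ e d k′ n h₁ h₂ h₃ =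
    lin 0 (≤-reflexive (sym h₁) ⊕ h₂ ⊕ h₃) (solve (β′ ∷ e ∷ d ∷ n ∷ V′ ∷ g′ ∷ k′ ∷ []))

first-period-fits : ∀ s l β p U′ g′ e d → s + l ≡ β → p ≤ l → suc U′ + (g′ + (suc e + d)) ≡ β →
    s + p ≤ suc U′ + g′ + (suc e + d)
first-period-fits s l β p U′ g′ e d h₁ h₂ h₃ =
    lin 0 (≤-reflexive h₁ ⊕ h₂ ⊕ ≤-reflexive (sym h₃))
        (solve (s ∷ p ∷ U′ ∷ g′ ∷ e ∷ d ∷ l ∷ β ∷ []))

p≤l∧l≤e⇒β′+p≤β′+[1+e+d] : ∀ p l e β′ d → p ≤ l → l ≤ e → β′ + p ≤ β′ + (suc e + d)
p≤l∧l≤e⇒β′+p≤β′+[1+e+d] p l e β′ d h₁ h₂ = lin (1 + d) (h₁ ⊕ h₂) (solve (β′ ∷ p ∷ e ∷ d ∷ l ∷ []))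

p+e≤e′∧3*e′<3*e+l∧l≤e⇒p≤e : ∀ p e e′ l → p + e ≤ e′ → 3 * e′ < 3 * e + l → l ≤ e → p ≤ e
p+e≤e′∧3*e′<3*e+l∧l≤e⇒p≤e p e e′ l h₁ h₂ h₃ =
    lin (1 + 2 * p) (h₁ ⊕ h₁ ⊕ h₁ ⊕ h₂ ⊕ h₃) (solve (p ∷ e ∷ e′ ∷ l ∷ []))

-- The chain is 3 p ≤ 3 (e′ ∸ e) < l ≤ e ≤ k; the factor 3 comes from cutting octaves into thirds.
p+e≤e′∧3*e′<3*e+l∧l≤e∧g+e≤k⇒3*p≤k : ∀ p e e′ l g k → p + e ≤ e′ → 3 * e′ < 3 * e + l → l ≤ e →
    g + e ≤ k → 3 * p ≤ k
p+e≤e′∧3*e′<3*e+l∧l≤e∧g+e≤k⇒3*p≤k p e e′ l g k h₁ h₂ h₃ h₄ =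
    lin (1 + g) (h₁ ⊕ h₁ ⊕ h₁ ⊕ h₂ ⊕ h₃ ⊕ h₄) (solve (p ∷ k ∷ e ∷ e′ ∷ l ∷ g ∷ []))

p+e≤e′∧3*e′<3*e+l∧l≤e∧g′+e′≤k′⇒3*p≤k′ : ∀ p e e′ l g′ k′ → p + e ≤ e′ → 3 * e′ < 3 * e + l → l ≤ e →
    g′ + e′ ≤ k′ → 3 * p ≤ k′
p+e≤e′∧3*e′<3*e+l∧l≤e∧g′+e′≤k′⇒3*p≤k′ p e e′ l g′ k′ h₁ h₂ h₃ h₄ =
    linᵍ 1 (p + g′ + 1) (4 ⊛ h₁ ⊕ h₂ ⊕ h₃ ⊕ h₄) (solve (p ∷ k′ ∷ g′ ∷ e ∷ e′ ∷ l ∷ []))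

p≤e′∧1+U′+[g′+e′]≡β⇒1+U′+g′+p≤β : ∀ p e′ U′ g′ β → p ≤ e′ → suc U′ + (g′ + e′) ≡ β →
    suc U′ + g′ + p ≤ β
p≤e′∧1+U′+[g′+e′]≡β⇒1+U′+g′+p≤β p e′ U′ g′ β h₁ h₂ =
    lin 0 (h₁ ⊕ ≤-reflexive h₂) (solve (U′ ∷ g′ ∷ p ∷ β ∷ e′ ∷ []))

e<e′∧1+U′+[g′+e′]≡β⇒1+U′+g′+e≤β : ∀ e e′ U′ g′ β → e < e′ → suc U′ + (g′ + e′) ≡ β →
    suc U′ + g′ + e ≤ β
e<e′∧1+U′+[g′+e′]≡β⇒1+U′+g′+e≤β e e′ U′ g′ β h₁ h₂ =
    lin 1 (h₁ ⊕ ≤-reflexive h₂) (solve (U′ ∷ g′ ∷ e ∷ β ∷ e′ ∷ []))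

1+U′+[g′+e′]≡β⇒1+U′+g′+e′≤β : ∀ U′ g′ e′ β → suc U′ + (g′ + e′) ≡ β → suc U′ + g′ + e′ ≤ β
1+U′+[g′+e′]≡β⇒1+U′+g′+e′≤β U′ g′ e′ β h₁ = lin 0 (≤-reflexive h₁) (solve (U′ ∷ g′ ∷ e′ ∷ β ∷ []))

prefix-inside-run₁ : ∀ V′ k′ g₂ p β g₁ β′ e′ U′ g′ → suc V′ + k′ ≡ g₂ + p →
    g₂ + p + β < g₁ + p + (β′ + e′) → suc U′ + (g′ + e′) ≡ β → suc V′ + g′ ≡ β′ →
        suc U′ + suc k′ ≤ g₁ + p
prefix-inside-run₁ V′ k′ g₂ p β g₁ β′ e′ U′ g′ h₁ h₂ h₃ h₄ =
    lin 0 (≤-reflexive h₁ ⊕ h₂ ⊕ ≤-reflexive h₃ ⊕ ≤-reflexive (sym h₄))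
        (solve (U′ ∷ k′ ∷ g₁ ∷ p ∷ V′ ∷ g₂ ∷ β ∷ β′ ∷ e′ ∷ g′ ∷ []))

-- Under the shift `e` the second run already starts before the first. The larger shift `e′` adds at
-- least `p` to this lead, and the match starts with the first run.
longer-suffix-inside-run₂ : ∀ U′ y₁ y₂ β β′ e g′ e′ V′ p → U′ ≡ y₁ →
    suc y₂ + β < suc y₁ + (β′ + e) → suc U′ + (g′ + e′) ≡ β → suc V′ + g′ ≡ β′ → p + e ≤ e′ →
        y₂ + p ≤ V′
longer-suffix-inside-run₂ U′ y₁ y₂ β β′ e g′ e′ V′ p h₁ h₂ h₃ h₄ h₅ =
    lin 1 (≤-reflexive (sym h₁) ⊕ h₂ ⊕ ≤-reflexive h₃ ⊕ ≤-reflexive (sym h₄) ⊕ h₅)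
        (solve (y₂ ∷ p ∷ V′ ∷ U′ ∷ y₁ ∷ β ∷ β′ ∷ e ∷ g′ ∷ e′ ∷ []))

prefix-inside-run₂ : ∀ U k g₁ p β′ e g₂ β g V → suc U + k ≡ g₁ + p →
    g₁ + p + (β′ + e) < g₂ + p + β → suc U + (g + e) ≡ β → suc V + g ≡ β′ → suc V + suc k ≤ g₂ + p
prefix-inside-run₂ U k g₁ p β′ e g₂ β g V h₁ h₂ h₃ h₄ =
    lin 0 (≤-reflexive h₁ ⊕ h₂ ⊕ ≤-reflexive (sym h₃) ⊕ ≤-reflexive h₄)
        (solve (V ∷ k ∷ g₂ ∷ p ∷ U ∷ g₁ ∷ β′ ∷ e ∷ β ∷ g ∷ []))

longer-suffix-inside-run₁ : ∀ V y₂ y₁ β′ e′ β U g e p → V ≡ y₂ → suc y₁ + (β′ + e′) < suc y₂ + β →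
    suc U + (g + e) ≡ β → suc V + g ≡ β′ → p + e ≤ e′ → y₁ + p ≤ U
longer-suffix-inside-run₁ V y₂ y₁ β′ e′ β U g e p h₁ h₂ h₃ h₄ h₅ =
    lin 1 (≤-reflexive (sym h₁) ⊕ h₂ ⊕ ≤-reflexive (sym h₃) ⊕ ≤-reflexive h₄ ⊕ h₅)
        (solve (y₁ ∷ p ∷ U ∷ V ∷ y₂ ∷ β′ ∷ e′ ∷ β ∷ g ∷ e ∷ []))

U+1+e≤1+n⇒e≤n : ∀ U e n → U + suc e ≤ suc n → e ≤ n
U+1+e≤1+n⇒e≤n U e n h₁ = lin U h₁ (solve (e ∷ n ∷ U ∷ []))

1+U+x≤U+1+e∧e<2*l⇒5*x<10*l : ∀ U x e l → suc U + x ≤ U + suc e → e < 2 * l → 5 * x < 10 * l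
1+U+x≤U+1+e∧e<2*l⇒5*x<10*l U x e l h₁ h₂ = linᵍ 2 9 (10 ⊛ h₁ ⊕ 10 ⊛ h₂) (solve (x ∷ l ∷ U ∷ e ∷ []))

1+U+x≤U+1+k⇒x≤k : ∀ U x k → suc U + x ≤ U + suc k → x ≤ k
1+U+x≤U+1+k⇒x≤k U x k h₁ = lin 0 h₁ (solve (x ∷ k ∷ U ∷ []))

x′+1+e≡x∧x≤k∧U+k≤n⇒1+e≤n : ∀ x′ e x k U n → x′ + suc e ≡ x → x ≤ k → U + k ≤ n → suc e ≤ n
x′+1+e≡x∧x≤k∧U+k≤n⇒1+e≤n x′ e x k U n h₁ h₂ h₃ =
    lin (U + x′) (≤-reflexive h₁ ⊕ h₂ ⊕ h₃) (solve (e ∷ n ∷ x′ ∷ x ∷ k ∷ U ∷ []))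

1+U+x≡1+U′+x′∧5*x<w+l∧w≤5*x′⇒5*U′<5*U+l : ∀ U x U′ x′ w l → suc U + x ≡ suc U′ + x′ →
    5 * x < w + l → w ≤ 5 * x′ → 5 * U′ < 5 * U + l
1+U+x≡1+U′+x′∧5*x<w+l∧w≤5*x′⇒5*U′<5*U+l U x U′ x′ w l h₁ h₂ h₃ =
    linᵍ 1 0 (5 ⊛ (≤-reflexive (sym h₁)) ⊕ h₂ ⊕ h₃) (solve (U′ ∷ U ∷ l ∷ x ∷ x′ ∷ w ∷ []))

-- Periodic factors of a text and maximal runs

module Text {B : Set α} (_≟_ : DecidableEquality B) (T : ℕ → B) ($ : B) (n : ℕ)
            (T₀≡$ : T 0 ≡ $) (Tₙ₊₁≡$ : T (suc n) ≡ $) (T≢$ : ∀ y → 1 ≤ y → y ≤ n → T y ≢ $) where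

  -- The factor T[s .. e) has period p; s and e are unrelated to the length of T.
  Per : ℕ → ℕ → ℕ → Set α
  Per p s e = ∀ y → s ≤ y → y + p < e → T y ≡ T (y + p)

  Copy : ℕ → ℕ → ℕ → Set α
  Copy m u v = ∀ t → t < m → T (u + t) ≡ T (v + t)

  copy-sym : ∀ {m u v} → Copy m u v → Copy m v u
  copy-sym c t t<m = sym (c t t<m)

  copy-trans : ∀ {m u v w} → Copy m u v → Copy m v w → Copy m u w
  copy-trans c d t t<m = trans (c t t<m) (d t t<m)

  copy-≤ : ∀ {m m′ u v} → m ≤ m′ → Copy m′ u v → Copy m u v
  copy-≤ m≤m′ c t t<m = c t (≤-trans t<m m≤m′)

  copy-shift : ∀ {m m′ u v} s → s + m ≤ m′ → Copy m′ u v → Copy m (u + s) (v + s)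
  copy-shift {m} {m′} {u} {v} s s+m≤m′ c t t<m =
    trans (cong T (+-assoc u s t))
      (trans (c (s + t) (lin 0 (t<m ⊕ s+m≤m′) (solve (s ∷ t ∷ m′ ∷ m ∷ []))))
             (cong T (sym (+-assoc v s t))))

  copy-tail : ∀ {m u v} → Copy (suc m) u v → Copy m (suc u) (suc v)
  copy-tail {m} {u} {v} c t t<m =
    trans (cong T (sym (+-suc u t))) (trans (c (suc t) (s≤s t<m)) (cong T (+-suc v t)))

  copy-head : ∀ {m u v} → Copy (suc m) u v → T u ≡ T v
  copy-head {m} {u} {v} c =
      trans (cong T (sym (+-identityʳ u))) (trans (c 0 z<s) (cong T (+-identityʳ v)))

  per-sub : ∀ {p s e s′ e′} → s ≤ s′ → e′ ≤ e → Per p s e → Per p s′ e′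
  per-sub s≤s′ e′≤e per y s′≤y y+p<e′ = per y (≤-trans s≤s′ s′≤y) (≤-trans y+p<e′ e′≤e)

  per-copy : ∀ {p m u v} → Copy m u v → Per p u (u + m) → Per p v (v + m)
  per-copy {p} {m} {u} {v} c per y v≤y y+p<v+m with m≤n⇒∃[o]m+o≡n v≤y
  ... | t , refl = begin
    T (v + t)        ≡⟨ c t (lin p y+p<v+m (solve (t ∷ m ∷ v ∷ p ∷ []))) ⟨
    T (u + t)        ≡⟨ per (u + t) (m≤m+n u t) (lin 0 y+p<v+m (solve (u ∷ t ∷ p ∷ m ∷ v ∷ []))) ⟩
    T (u + t + p)    ≡⟨ cong T (+-assoc u t p) ⟩
    T (u + (t + p))  ≡⟨ c (t + p) (lin 0 y+p<v+m (solve (t ∷ p ∷ m ∷ v ∷ []))) ⟩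
    T (v + (t + p))  ≡⟨ cong T (+-assoc v t p) ⟨
    T (v + t + p)    ∎
    where open ≡-Reasoning

  copy-periodic : ∀ {p m u v} → 1 ≤ p → Copy p u v → Per p u (u + m) → Per p v (v + m) → Copy m u v
  copy-periodic {p} {m} {u} {v} 1≤p c peru perv t t<m = go (suc t) t ≤-refl t<m
    where
    open ≡-Reasoning
    go : ∀ d t → t < d → t < m → T (u + t) ≡ T (v + t)
    go (suc d) t t<d t<m with t <? p
    ... | yes t<p = c t t<p
    ... | no t≮p with m≤n⇒∃[o]m+o≡n (≮⇒≥ t≮p)
    ...   | w , refl = begin
      T (u + (p + w))  ≡⟨ cong T (solve (u ∷ p ∷ w ∷ [])) ⟩
      T (u + w + p)    ≡⟨ peru (u + w) (m≤m+n u w) (lin 0 t<m (solve (u ∷ w ∷ p ∷ m ∷ []))) ⟨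
      T (u + w)        ≡⟨ go d w (lin 0 (t<d ⊕ 1≤p) (solve (w ∷ d ∷ p ∷ [])))
          (lin p t<m (solve (w ∷ m ∷ p ∷ []))) ⟩
      T (v + w)        ≡⟨ perv (v + w) (m≤m+n v w) (lin 0 t<m (solve (v ∷ w ∷ p ∷ m ∷ []))) ⟩
      T (v + w + p)    ≡⟨ cong T (solve (v ∷ p ∷ w ∷ [])) ⟨
      T (v + (p + w))  ∎

  -- A weak form of the Fine–Wilf theorem: shifting by multiples of p moves both
  -- members of a pair at distance q into the overlap.
  per-extend : ∀ {p q s e s₁ e₁} → 1 ≤ p → Per p s e → Per q s₁ e₁ → s ≤ s₁ → e₁ ≤ e →
               s₁ + p + q ≤ e₁ → Per q s e
  per-extend {p} {q} {s} {e} {s₁} {e₁} 1≤p perp perq s≤s₁ e₁≤e long y s≤y y+q<e =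
      right (suc y) y ≤-refl s≤y y+q<e
    where
    open ≡-Reasoning
    left : ∀ d y → s ≤ y → s₁ ≤ y + d → y + q < e₁ → T y ≡ T (y + q)
    left d y s≤y s₁≤y+d y+q<e₁ with s₁ ≤? y
    ... | yes s₁≤y = perq y s₁≤y y+q<e₁
    left zero y s≤y s₁≤y+d y+q<e₁ | no s₁≰y =
        contradiction (subst (s₁ ≤_) (+-identityʳ y) s₁≤y+d) s₁≰y
    left (suc d) y s≤y s₁≤y+d y+q<e₁ | no s₁≰y = begin
      T y            ≡⟨ perp y s≤y (lin q ((≰⇒> s₁≰y) ⊕ long ⊕ e₁≤e)
          (solve (y ∷ p ∷ e ∷ s₁ ∷ q ∷ e₁ ∷ []))) ⟩
      T (y + p)      ≡⟨ left d (y + p) (lin p s≤y (solve (s ∷ y ∷ p ∷ [])))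
                          (lin 0 (s₁≤y+d ⊕ 1≤p) (solve (s₁ ∷ y ∷ p ∷ d ∷ [])))
                          (lin 0 ((≰⇒> s₁≰y) ⊕ long) (solve (y ∷ p ∷ q ∷ e₁ ∷ s₁ ∷ []))) ⟩
      T (y + p + q)  ≡⟨ cong T (solve (y ∷ p ∷ q ∷ [])) ⟩
      T (y + q + p)  ≡⟨ perp (y + q) (lin q s≤y (solve (s ∷ y ∷ q ∷ [])))
                          (lin 0 ((≰⇒> s₁≰y) ⊕ long ⊕ e₁≤e) (solve (y ∷ q ∷ p ∷ e ∷ s₁ ∷ e₁ ∷ [])))
                                  ⟨
      T (y + q)      ∎
    right : ∀ d y → y < d → s ≤ y → y + q < e → T y ≡ T (y + q)
    right (suc d) y y<d s≤y y+q<e with y + q <? e₁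
    ... | yes y+q<e₁ = left s₁ y s≤y (m≤n+m s₁ y) y+q<e₁
    ... | no y+q≮e₁ with m≤n⇒∃[o]m+o≡n {s₁ + p} {y} (lin 0 ((≮⇒≥ y+q≮e₁) ⊕ long)
            (solve (s₁ ∷ p ∷ y ∷ e₁ ∷ q ∷ [])))
    ...   | r , refl = begin
      T (s₁ + p + r)      ≡⟨ cong T (solve (s₁ ∷ p ∷ r ∷ [])) ⟩
      T (s₁ + r + p)           ≡⟨ perp (s₁ + r) s≤w (lin q y+q<e (solve (s₁ ∷ r ∷ p ∷ e ∷ q ∷ [])))
          ⟨
      T (s₁ + r)                 ≡⟨ right d (s₁ + r)
          (lin 0 (y<d ⊕ 1≤p) (solve (s₁ ∷ r ∷ d ∷ p ∷ []))) s≤w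
                               (lin p y+q<e (solve (s₁ ∷ r ∷ q ∷ e ∷ p ∷ []))) ⟩
      T (s₁ + r + q)           ≡⟨ perp (s₁ + r + q) (lin q s≤w (solve (s ∷ s₁ ∷ r ∷ q ∷ [])))
                               (lin 0 y+q<e (solve (s₁ ∷ r ∷ q ∷ p ∷ e ∷ []))) ⟩
      T (s₁ + r + q + p)       ≡⟨ cong T (solve (s₁ ∷ p ∷ r ∷ q ∷ [])) ⟨
      T (s₁ + p + r + q)  ∎
      where
      s≤w : s ≤ s₁ + r
      s≤w = lin r s≤s₁ (solve (s ∷ s₁ ∷ r ∷ []))

  Per? : ∀ p s e → Dec (Per p s e)
  Per? p s e = map′ (λ f y s≤y y+p<e → f (m+n≤o⇒m≤o (suc y) y+p<e) s≤y y+p<e)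
                    (λ per {y} _ s≤y y+p<e → per y s≤y y+p<e)
                    (allUpTo? (λ y → (s ≤? y) →-dec (y + p <? e) →-dec (T y ≟ T (y + p))) e)

  leftEnd : ∀ p s → ∃[ c ] (c ≤ s × (∀ y → c ≤ y → y < s → T y ≡ T (y + p)) ×
                            (c ≡ 0 ⊎ ∃[ y ] (c ≡ suc y × T y ≢ T (y + p))))
  leftEnd p zero = 0 , z≤n , (λ _ _ ()) , inj₁ refl
  leftEnd p (suc s) with T s ≟ T (s + p)
  ... | no break = suc s , ≤-refl , (λ y c≤y y<c → contradiction c≤y (<⇒≱ y<c)) ,
          inj₂ (s , refl , break)
  ... | yes eq with leftEnd p s
  ...   | c , c≤s , inside , break = c , m≤n⇒m≤1+n c≤s , inside′ , break
    where
    inside′ : ∀ y → c ≤ y → y < suc s → T y ≡ T (y + p)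
    inside′ y c≤y y<1+s with m<1+n⇒m<n∨m≡n y<1+s
    ... | inj₁ y<s  = inside y c≤y y<s
    ... | inj₂ refl = eq

  rightEnd : ∀ p s N → ∃[ c ] (s ≤ c × (∀ y → s ≤ y → y < c → T y ≡ T (y + p)) ×
                               (T c ≢ T (c + p) ⊎ N + s ≤ c))
  rightEnd p s zero = s , ≤-refl , (λ y c≤y y<c → contradiction c≤y (<⇒≱ y<c)) , inj₂ ≤-refl
  rightEnd p s (suc N) with T s ≟ T (s + p)
  ... | no break = s , ≤-refl , (λ y c≤y y<c → contradiction c≤y (<⇒≱ y<c)) , inj₁ break
  ... | yes eq with rightEnd p (suc s) N
  ...   | c , s<c , inside , break =
    c , <⇒≤ s<c , inside′ , [ inj₁ , (λ le → inj₂ (≤-trans (≤-reflexive (sym (+-suc N s))) le)) ]′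
        break
    where
    inside′ : ∀ y → s ≤ y → y < c → T y ≡ T (y + p)
    inside′ y s≤y y<c with m≤n⇒m<n∨m≡n s≤y
    ... | inj₁ s<y  = inside y s<y y<c
    ... | inj₂ refl = eq

  -- The maximal p-periodic interval around the pair (s , s + p) is
  -- [start .. last + p); the search to the right gives up at N.
  record Run (p s N : ℕ) : Set α where
    field
      start last : ℕ
      start≤     : start ≤ s
      ≤last      : s ≤ last
      periodic   : Per p start (last + p)
      leftBreak  : start ≡ 0 ⊎ ∃[ y ] (start ≡ suc y × T y ≢ T (y + p))
      rightBreak : T last ≢ T (last + p) ⊎ N ≤ last

  run : ∀ p s N → Run p s N
  run p s N with leftEnd p s | rightEnd p s N
  ... | c , c≤s , insideˡ , breakˡ | d , s≤d , insideʳ , breakʳ = record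
    { start = c ; last = d ; start≤ = c≤s ; ≤last = s≤d ; periodic = periodic
    ; leftBreak = breakˡ ; rightBreak = [ inj₁ , (λ le → inj₂ (≤-trans (m≤m+n N s) le)) ]′ breakʳ }
    where
    periodic : Per p c (d + p)
    periodic y c≤y y+p<d+p with y <? s
    ... | yes y<s = insideˡ y c≤y y<s
    ... | no y≮s  = insideʳ y (≮⇒≥ y≮s) (+-cancelʳ-< p y d y+p<d+p)

  module _ {p s N} (R : Run p s N) {c d} (per : Per p c d) (c≤s : c ≤ s) (s+p≤d : s + p ≤ d) where
    open Run R

    -- Otherwise the break just before `start` is a pair at distance `p` inside `[c .. d)`, because
    -- this interval contains the whole window `[s .. s + p)`.
    start-covers : start ≤ c
    start-covers with leftBreak
    ... | inj₁ start≡0 = ≤-trans (≤-reflexive start≡0) z≤n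
    ... | inj₂ (y , refl , break) = ≮⇒≥ λ c<start →
      break (per y (≤-pred c<start) (lin 0 (start≤ ⊕ s+p≤d) (solve (y ∷ p ∷ d ∷ s ∷ []))))

    last-covers : d ≤ N + p → d ≤ last + p
    last-covers d≤N+p with rightBreak
    ... | inj₁ break = ≮⇒≥ λ last+p<d → break (per last (≤-trans c≤s ≤last) last+p<d)
    ... | inj₂ N≤last = ≤-trans d≤N+p (+-monoˡ-≤ p N≤last)

  -- Maximal matches against periodic runs

  -- In the alignment of `U` with `V`, the last inequality says that the second run starts before
  -- the first. If the match began inside the first run, `T U` and `T V` would each repeat `p`
  -- later, inside the match, and so agree. If it began earlier, it would carry the period of the
  -- second run onto the left break `s₁`.
  start-at-run : ∀ {U V k p s₁ f₁ s₂ f₂ m} → Copy k (suc U) (suc V) → T U ≢ T V →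
    Per p (suc s₁) f₁ → Per p s₂ f₂ → T s₁ ≢ T (s₁ + p) →
    1 ≤ p → p ≤ m → m ≤ k → suc U + m ≤ f₁ → suc V + m ≤ f₂ → suc s₁ + p ≤ suc U + m →
    s₂ + suc U < suc s₁ + suc V → U ≡ s₁
  start-at-run {U} {V} {k} {suc p} {s₁} {f₁} {s₂} {f₂} {m} copy U≢V per₁ per₂ break 1≤p p≤m m≤k
      U+m≤f₁ V+m≤f₂ s₁+p≤U+m diag
    with <-cmp U s₁
  ... | tri≈ _ eq _ = eq
  ... | tri> _ _ s₁<U = contradiction eq U≢V
    where
    open ≡-Reasoning
    eq : T U ≡ T V
    eq = begin
      T U            ≡⟨ per₁ U s₁<U (lin 0 (U+m≤f₁ ⊕ p≤m) (solve (U ∷ p ∷ f₁ ∷ m ∷ []))) ⟩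
      T (U + suc p)  ≡⟨ cong T (+-suc U p) ⟩
      T (suc U + p)  ≡⟨ copy p (≤-trans p≤m m≤k) ⟩
      T (suc V + p)  ≡⟨ cong T (+-suc V p) ⟨
      T (V + suc p)  ≡⟨ per₂ V (lin 1 (diag ⊕ s₁<U) (solve (s₂ ∷ V ∷ U ∷ s₁ ∷ [])))
                               (lin 0 (V+m≤f₂ ⊕ p≤m) (solve (V ∷ p ∷ f₂ ∷ m ∷ []))) ⟨
      T V            ∎
  ... | tri< U<s₁ _ _ with m≤n⇒∃[o]m+o≡n U<s₁
  ...   | t , refl = contradiction eq break
    where
    open ≡-Reasoning
    eq : T (suc U + t) ≡ T (suc U + t + suc p)
    eq = begin
      T (suc U + t)              ≡⟨ copy t (lin (1 + p) (s₁+p≤U+m ⊕ m≤k)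
          (solve (t ∷ k ∷ U ∷ p ∷ m ∷ []))) ⟩
      T (suc V + t)              ≡⟨ per₂ (suc V + t) (lin 0 diag (solve (s₂ ∷ V ∷ t ∷ U ∷ [])))
                                      (lin 0 (V+m≤f₂ ⊕ s₁+p≤U+m)
                                              (solve (V ∷ t ∷ p ∷ f₂ ∷ m ∷ U ∷ []))) ⟩
      T (suc V + t + suc p)      ≡⟨ cong T (+-assoc (suc V) t (suc p)) ⟩
      T (suc V + (t + suc p))    ≡⟨ copy (t + suc p) (lin 0 (s₁+p≤U+m ⊕ m≤k)
          (solve (t ∷ p ∷ k ∷ U ∷ m ∷ []))) ⟨
      T (suc U + (t + suc p))    ≡⟨ cong T (+-assoc (suc U) t (suc p)) ⟨
      T (suc U + t + suc p)      ∎

  -- The mirror image of `start-at-run`: now the first run ends before the second one. Ending too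
  -- early makes the mismatching characters repeat equal ones `p` before; ending too late carries
  -- the period across the break `g₁`.
  end-at-run : ∀ {U V k p s₁ g₁ s₂ f₂ m} → Copy k U V → T (U + k) ≢ T (V + k) →
    Per p s₁ (g₁ + p) → Per p s₂ f₂ → T g₁ ≢ T (g₁ + p) →
    1 ≤ p → s₁ ≤ U + m → s₂ ≤ V + m → m + p ≤ k → U + m + p ≤ g₁ + p →
    g₁ + p + V < f₂ + U → U + k ≡ g₁ + p
  end-at-run {U} {V} {k} {p} {s₁} {g₁} {s₂} {f₂} {m} copy end≢ per₁ per₂ break 1≤p s₁≤U+m s₂≤V+m
      m+p≤k U+m+p≤f₁ diag
    with <-cmp (U + k) (g₁ + p)
  ... | tri≈ _ eq _ = eq
  ... | tri< U+k<f₁ _ _ with m≤n⇒∃[o]m+o≡n m+p≤k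
  ...   | w , refl = contradiction eq end≢
    where
    open ≡-Reasoning
    eq : T (U + (m + p + w)) ≡ T (V + (m + p + w))
    eq = begin
      T (U + (m + p + w))    ≡⟨ cong T (solve (U ∷ m ∷ p ∷ w ∷ [])) ⟩
      T (U + (m + w) + p)    ≡⟨ per₁ (U + (m + w)) (lin w s₁≤U+m (solve (s₁ ∷ U ∷ m ∷ w ∷ [])))
                                  (lin 0 U+k<f₁ (solve (U ∷ m ∷ w ∷ p ∷ g₁ ∷ []))) ⟨
      T (U + (m + w))        ≡⟨ copy (m + w) (lin 0 1≤p (solve (m ∷ w ∷ p ∷ []))) ⟩
      T (V + (m + w))        ≡⟨ per₂ (V + (m + w)) (lin w s₂≤V+m (solve (s₂ ∷ V ∷ m ∷ w ∷ [])))
                                  (lin 1 (U+k<f₁ ⊕ diag)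
                                          (solve (V ∷ m ∷ w ∷ p ∷ f₂ ∷ U ∷ g₁ ∷ []))) ⟩
      T (V + (m + w) + p)    ≡⟨ cong T (solve (V ∷ m ∷ p ∷ w ∷ [])) ⟨
      T (V + (m + p + w))    ∎
  end-at-run {U} {V} {k} {p} {s₁} {g₁} {s₂} {f₂} {m} copy end≢ per₁ per₂ break 1≤p s₁≤U+m s₂≤V+m
      m+p≤k U+m+p≤f₁ diag
    | tri> _ _ f₁<U+k with m≤n⇒∃[o]m+o≡n {U + m} {g₁} (lin 0 U+m+p≤f₁ (solve (U ∷ m ∷ g₁ ∷ p ∷ [])))
  ...   | w , refl = contradiction eq break
    where
    open ≡-Reasoning
    eq : T (U + m + w) ≡ T (U + m + w + p)
    eq = begin
      T (U + m + w)          ≡⟨ cong T (+-assoc U m w) ⟩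
      T (U + (m + w))        ≡⟨ copy (m + w) (lin p f₁<U+k (solve (m ∷ w ∷ k ∷ U ∷ p ∷ []))) ⟩
      T (V + (m + w))        ≡⟨ per₂ (V + (m + w)) (lin w s₂≤V+m (solve (s₂ ∷ V ∷ m ∷ w ∷ [])))
                                  (lin 0 diag (solve (V ∷ m ∷ w ∷ p ∷ f₂ ∷ U ∷ []))) ⟩
      T (V + (m + w) + p)    ≡⟨ cong T (+-assoc V (m + w) p) ⟩
      T (V + (m + w + p))    ≡⟨ copy (m + w + p) (lin 0 f₁<U+k (solve (m ∷ w ∷ p ∷ k ∷ U ∷ []))) ⟨
      T (U + (m + w + p))    ≡⟨ cong T (solve (U ∷ m ∷ w ∷ p ∷ [])) ⟩
      T (U + m + w + p)      ∎

  -- [suc U .. suc U + (m + p)) is maximal among the intervals of period p, which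
  -- is at most a third of its length.
  record MaximalRun (U p m : ℕ) : Set α where
    field
      1≤p        : 1 ≤ p
      short      : 3 * p ≤ m + p
      periodic   : Per p (suc U) (suc U + (m + p))
      leftBreak  : T U ≢ T (U + p)
      rightBreak : T (suc U + m) ≢ T (suc U + (m + p))

  private
    -- Let e = m + p and e′ = m′ + p′. Then e < e′ + l / 3 ≤ 4 e′ / 3, so p + p′ < 4 e′ / 9 + e′ / 3
    -- = 7 e′ / 9.
    roomˡ : ∀ {c p m p′ m′ l} → 3 * p ≤ m + p → 3 * p′ ≤ m′ + p′ → 3 * (m + p) < 3 * (m′ + p′) + l →
           l ≤ m′ + p′ → c + p + p′ ≤ c + (m′ + p′)
    roomˡ {c} {p} {m} {p′} {m′} {l} short short′ close l≤e′ =
      (linᵍ 9 (6 * p′ + 9) (3 ⊛ short ⊕ 5 ⊛ short′ ⊕ close ⊕ l≤e′)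
              (solve (c ∷ p ∷ p′ ∷ m′ ∷ m ∷ l ∷ [])))

    -- The second run starts `suc t` < l / 5 ≤ e / 5 later, p ≤ e / 3 and p′ ≤ e′ / 3 < 4 e / 9,
    -- which adds up to less than 44 e / 45. With quarters in place of fifths this estimate would
    -- exceed e.
    roomʳ : ∀ {U t p m p′ m′ l} → 3 * p ≤ m + p → 3 * p′ ≤ m′ + p′ → 5 * (suc U + t) < 5 * U + l →
            3 * (m′ + p′) < 3 * (m + p) + l → l ≤ m + p → suc (suc U + t) + p + p′ ≤ suc U + (m + p)
    roomʳ {U} {t} {p} {m} {p′} {m′} {l} short short′ close close′ l≤e =
      (linᵍ 54 (6 * t + 77) (18 ⊛ short ⊕ 18 ⊛ short′ ⊕ 12 ⊛ close ⊕ 6 ⊛ close′ ⊕ 18 ⊛ l≤e)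
              (solve (U ∷ t ∷ p ∷ p′ ∷ m ∷ m′ ∷ l ∷ [])))

  -- Two runs in the same size class l that start within l / 5 of each other
  -- overlap in at least p + p′ positions.
  module _ {U p m U′ p′ m′ l} (R : MaximalRun U p m) (R′ : MaximalRun U′ p′ m′)
           (l≤e : l ≤ m + p) (l≤e′ : l ≤ m′ + p′)
           (e′≈e : 3 * (m′ + p′) < 3 * (m + p) + l) (e≈e′ : 3 * (m + p) < 3 * (m′ + p′) + l) where
    private
      module R = MaximalRun R
      module R′ = MaximalRun R′

    -- The overlap spreads the period `p′` over all of `R`. As `R` contains `U′`, the position just
    -- before the other run, `p′` would continue across the left break there.
    runs-start-≮ : 5 * U′ < 5 * U + l → ¬ U < U′
    runs-start-≮ close U<U′ with m≤n⇒∃[o]m+o≡n U<U′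
    ... | t , refl = R′.leftBreak (per (suc U + t) (m≤m+n (suc U) t)
      (linᵍ 9 (16 * t + 30) (3 ⊛ R′.short ⊕ 5 ⊛ close ⊕ e′≈e ⊕ 6 ⊛ l≤e)
              (solve (U ∷ t ∷ p′ ∷ m ∷ p ∷ m′ ∷ l ∷ []))))
      where
      per : Per p′ (suc U) (suc U + (m + p))
      per = per-extend R.1≤p R.periodic
        (per-sub ≤-refl (m⊓n≤n (suc U + (m + p)) (suc (suc U + t) + (m′ + p′))) R′.periodic)
                (lin (1 + t) (z≤n {0}) (solve (U ∷ t ∷ []))) (m⊓n≤m (suc U + (m + p))
                        (suc (suc U + t) + (m′ + p′)))
        (⊓-glb
          (roomʳ {U} {t} {p} {m} {p′} {m′} R.short R′.short close e′≈e l≤e)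
          (roomˡ {suc (suc U + t)} {p} {m} {p′} {m′} R.short R′.short e≈e′ l≤e′))

    -- Equal starts nest the shorter run in the longer one, so `p` spreads over the longer run and
    -- across the right break of the shorter.
    runs-end-≮ : U ≡ U′ → ¬ m + p < m′ + p′
    runs-end-≮ refl e<e′ = R.rightBreak (trans (per (suc U + m) (m≤m+n (suc U) m)
        (lin 0 e<e′ (solve (U ∷ m ∷ p ∷ m′ ∷ p′ ∷ []))))
      (cong T (+-assoc (suc U) m p)))
      where
      per : Per p (suc U) (suc U + (m′ + p′))
      per = per-extend R′.1≤p R′.periodic R.periodic ≤-refl
          (lin 1 e<e′ (solve (U ∷ m ∷ p ∷ m′ ∷ p′ ∷ [])))
        (roomˡ {suc U} {p′} {m′} {p} {m} R′.short R.short e′≈e l≤e)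

  -- Sentinels, copies of runs, and short runs

  ¬per-at-0 : ∀ {p e} → 1 ≤ p → p ≤ n → p < e → ¬ Per p 0 e
  ¬per-at-0 {p} 1≤p p≤n p<e per = T≢$ p 1≤p p≤n (trans (sym (per 0 z≤n p<e)) T₀≡$)

  -- The period would repeat the closing sentinel `p` positions earlier, at a position in 1 .. n.
  ¬per-at-end : ∀ {p s e} → 1 ≤ p → 1 ≤ s → s + p ≤ suc n → suc n < e → ¬ Per p s e
  ¬per-at-end {p} {s} {e} 1≤p 1≤s s+p≤n+1 n+1<e per
    with m≤n⇒∃[o]m+o≡n {p} {suc n} (s+p≤1+n⇒p≤1+n s p n s+p≤n+1)
  ... | y , p+y≡n+1 = T≢$ y (s+p≤1+n∧1≤s∧p+y≡1+n⇒1≤y s p n y s+p≤n+1 1≤s p+y≡n+1)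
      (p+y≡1+n∧1≤p⇒y≤n p y n p+y≡n+1 1≤p)
      (trans (per y (s+p≤1+n∧p+y≡1+n⇒s≤y s p n y s+p≤n+1 p+y≡n+1)
                    (p+y≡1+n∧1+n<e⇒y+p<e p y n e p+y≡n+1 n+1<e))
             (trans (cong T (trans (+-comm y p) p+y≡n+1)) Tₙ₊₁≡$))

  MaximalRun? : ∀ U p m → Dec (MaximalRun U p m)
  MaximalRun? U p m = map′
    (λ (a , b , c , d , e) →
            record { 1≤p = a ; short = b ; periodic = c ; leftBreak = d ; rightBreak = e })
    (λ r → let open MaximalRun r in 1≤p , short , periodic , leftBreak , rightBreak)
    ((1 ≤? p) ×-dec (3 * p ≤? m + p) ×-dec Per? p (suc U) (suc U + (m + p)) ×-dec
     ¬? (T U ≟ T (U + p)) ×-dec ¬? (T (suc U + m) ≟ T (suc U + (m + p))))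

  -- The copy has one extra character on each side of the run; these carry the two breaks.
  run-copy : ∀ {p m U U′} → Copy (suc (suc (m + p))) U U′ → MaximalRun U p m → MaximalRun U′ p m
  run-copy {p} {m} {U} {U′} copy r = record
    { 1≤p = 1≤p
    ; short = short
    ; periodic = per-copy (copy-≤ (n≤1+n _) (copy-tail copy)) periodic
    ; leftBreak = λ eq → leftBreak (trans (copy-head copy)
        (trans eq (sym (copy p (s≤s (m≤n⇒m≤1+n (m≤n+m p m)))))))
    ; rightBreak = λ eq → rightBreak (trans (copy-tail copy m (s≤s (m≤m+n m p)))
                            (trans eq (sym (copy-tail copy (m + p) ≤-refl))))
    }
    where open MaximalRun r

  -- The suffix at suc u and its common prefix of length k with a neighbour: the
  -- prefix lies in a run that starts with it and ends less than p after it.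
  ShortRun : ℕ → ℕ → ℕ → ℕ → Set α
  ShortRun u k p m = m ≤ k × k < m + p × MaximalRun u p m

  Short : ℕ → ℕ → Set α
  Short u k = ∃[ p ] (p < suc k × ∃[ m ] (m < suc k × ShortRun u k p m))

  Short? : ∀ u k → Dec (Short u k)
  Short? u k = anyUpTo? (λ p → anyUpTo? (λ m → (m ≤? k) ×-dec (k <? m + p) ×-dec MaximalRun? u p m)
      (suc k)) (suc k)

  shortRun-fits : ∀ {u k p m} → u + k ≤ n → ShortRun u k p m → u + suc (m + p) ≤ suc n
  shortRun-fits {u} {k} {p} {m} u+k≤n (m≤k , k<m+p , r) = ≮⇒≥ λ (out : suc n < u + suc (m + p)) →
    ¬per-at-end {p} {suc u} {suc u + (m + p)} 1≤p (s≤s z≤n) (u+k≤n∧3*p≤m+p∧m≤k⇒1+u+p≤1+n u k n p m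
        u+k≤n short m≤k) (1+n<u+1+[m+p]⇒1+n<1+u+[m+p] n u m p out) periodic
    where open MaximalRun r

  -- The period is followed for `p` further characters. If it first fails after `j < p` of them, the
  -- run ending there has length `suc k + j`, which is `m + p` with `m ≤ k`.
  short-or-periodic : ∀ {u k p} → 1 ≤ p → 3 * p ≤ k → Per p (suc u) (suc u + suc k) →
      T u ≢ T (u + p) →
                      Short u k ⊎ Per p (suc u) (suc u + (suc k + p))
  short-or-periodic {u} {k} {p} 1≤p 3p≤k per break = go p ≤-refl
    where
    go : ∀ j → j ≤ p → Short u k ⊎ Per p (suc u) (suc u + (suc k + j))
    go zero _ = inj₂ (subst (λ e → Per p (suc u) (suc u + e)) (sym (+-identityʳ (suc k))) per)
    go (suc j) j<p with go j (<⇒≤ j<p)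
    ... | inj₁ short = inj₁ short
    ... | inj₂ perⱼ with m≤n⇒∃[o]m+o≡n {p} {suc k + j} (3*p≤k⇒p≤1+k+j p k j 3p≤k)
    ...   | m , p+m≡ with T (suc u + m) ≟ T (suc u + (m + p))
    ...     | no end = inj₁ (p , (3*p≤k⇒p<1+k p k 3p≤k) , m , s≤s m≤k , m≤k ,
                (p+m≡1+k+j⇒k<m+p p m k j p+m≡) , record
                { 1≤p = 1≤p
                ; short = 3*p≤k∧p+m≡1+k+j⇒3*p≤m+p p k m j 3p≤k p+m≡
                ; periodic = subst (λ e → Per p (suc u) (suc u + e)) (trans (sym p+m≡) (+-comm p m))
                    perⱼ
                ; leftBreak = break
                ; rightBreak = end
                })
              where
              m≤k : m ≤ k
              m≤k = p+m≡1+k+j∧j<p⇒m≤k p m k j p+m≡ j<p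
    ...     | yes eq = inj₂ perⱼ₊₁
      where
      perⱼ₊₁ : Per p (suc u) (suc u + (suc k + suc j))
      perⱼ₊₁ y u<y y+p< with y + p <? suc u + (suc k + j)
      ... | yes inside = perⱼ y u<y inside
      ... | no ¬inside = trans (cong T y≡)
              (trans eq (cong T (trans (sym (+-assoc (suc u) m p)) (cong (_+ p) (sym y≡)))))
        where
        y≡ : y ≡ suc u + m
        y≡ = new-position≡ y p u k j m y+p< (≮⇒≥ ¬inside) p+m≡

  -- The suffix order and adjacent suffixes

  module Order (_≺_ : Rel B ℓ) (≺-irrefl : ∀ {x y} → x ≺ y → x ≢ y) where

    Branch : ℕ → ℕ → ℕ → Set (α ⊔ ℓ)
    Branch k u v = Copy k u v × T (u + k) ≺ T (v + k)

    infix 4 _⊏_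
    _⊏_ : ℕ → ℕ → Set (α ⊔ ℓ)
    u ⊏ v = ∃[ k ] Branch k u v

    branch-resp : ∀ {k u u′ v v′} → Copy (suc k) u u′ → Copy (suc k) v v′ → Branch k u v →
        Branch k u′ v′
    branch-resp {k} {u} {u′} {v} {v′} cu cv (copy , u≺v) =
      copy-trans (copy-sym (copy-≤ (n≤1+n k) cu)) (copy-trans copy (copy-≤ (n≤1+n k) cv)) ,
      subst₂ _≺_ (cu k ≤-refl) (cv k ≤-refl) u≺v

    -- Rotations are named by their index in the enumeration, so the suffix with
    -- preceding character T u starts at suc u.
    record Boundary (u v k : ℕ) : Set (α ⊔ ℓ) where
      field
        u+k≤n    : u + k ≤ n
        v+k≤n    : v + k ≤ n
        pre≢     : T u ≢ T v
        branch   : Branch k (suc u) (suc v)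
        adjacent : ∀ x → x ≤ n → suc u ⊏ suc x → suc x ⊏ suc v → ⊥

      copy : Copy k (suc u) (suc v)
      copy = proj₁ branch

      end≢ : T (suc u + k) ≢ T (suc v + k)
      end≢ = ≺-irrefl (proj₂ branch)

      u≤n : u ≤ n
      u≤n = m+n≤o⇒m≤o u u+k≤n

      v≤n : v ≤ n
      v≤n = m+n≤o⇒m≤o v v+k≤n

    module Sorted (compare : ∀ x y → x ≤ n → y ≤ n → suc x ⊏ suc y ⊎ (x ≡ y ⊎ suc y ⊏ suc x)) where

      -- If `k < k′`, the suffix at `suc v′` agrees with that at `suc u` beyond `k` and branches
      -- upwards from it at `k′`, so it lies strictly between `suc u` and `suc v`. If `k ≡ k′`, the
      -- larger of two distinct lower suffixes lies between the smaller one and its upper neighbour.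
      same-lower : ∀ {u v k u′ v′ k′ e} → Boundary u v k → Boundary u′ v′ k′ →
                   Copy e (suc u) (suc u′) → k < e → k′ < e → u ≡ u′
      same-lower {u} {v} {k} {u′} {v′} {k′} {e} b b′ copy k<e k′<e with <-cmp k k′
      ... | tri< k<k′ _ _ = ⊥-elim (b.adjacent v′ b′.v≤n
          (k′ , branch-resp (copy-≤ k′<e (copy-sym copy)) (λ _ _ → refl) b′.branch)
          (k , branch-resp (copy-≤ k<k′ (copy-trans (copy-≤ (<⇒≤ k′<e) copy) b′.copy)) (λ _ _ →
                  refl) b.branch))
        where
        module b = Boundary b
        module b′ = Boundary b′
      ... | tri> _ _ k′<k = ⊥-elim (b′.adjacent v b.v≤n
          (k , branch-resp (copy-≤ k<e copy) (λ _ _ → refl) b.branch)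
          (k′ , branch-resp (copy-≤ k′<k (copy-trans (copy-≤ (<⇒≤ k<e) (copy-sym copy)) b.copy))
                  (λ _ _ → refl) b′.branch))
        where
        module b = Boundary b
        module b′ = Boundary b′
      ... | tri≈ _ refl _ with compare u u′ (Boundary.u≤n b) (Boundary.u≤n b′)
      ...   | inj₂ (inj₁ eq) = eq
      ...   | inj₁ u⊏u′ = ⊥-elim (Boundary.adjacent b u′ (Boundary.u≤n b′) u⊏u′
                (k , branch-resp (copy-≤ k<e copy) (λ _ _ → refl) (Boundary.branch b)))
      ...   | inj₂ (inj₂ u′⊏u) = ⊥-elim (Boundary.adjacent b′ u (Boundary.u≤n b) u′⊏u
                (k , branch-resp (copy-≤ k<e (copy-sym copy)) (λ _ _ → refl) (Boundary.branch b′)))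

      -- The copied runs have the same start and the same length. Hence the two lower suffixes share
      -- `m + p` characters, more than either common prefix, and `same-lower` applies.
      short-inj : ∀ {u v k p m U u′ v′ k′ p′ m′ U′ l} →
        Boundary u v k → Boundary u′ v′ k′ → ShortRun u k p m → ShortRun u′ k′ p′ m′ →
        Copy (suc (suc (m + p))) U u → Copy (suc (suc (m′ + p′))) U′ u′ →
        l ≤ m + p → l ≤ m′ + p′ → 3 * (m′ + p′) < 3 * (m + p) + l →
            3 * (m + p) < 3 * (m′ + p′) + l →
        5 * U′ < 5 * U + l → 5 * U < 5 * U′ + l → u ≡ u′
      short-inj {u} {v} {k} {p} {m} {U} {u′} {v′} {k′} {p′} {m′} {U′} b b′ (m≤k , k< , r) (m′≤k′ ,
          k′< , r′) cu cu′ l≤e l≤e′ e′≈e e≈e′ U′≈U U≈U′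
        with ≤-antisym (≮⇒≥ (runs-start-≮ R′ R l≤e′ l≤e e≈e′ e′≈e U≈U′))
                (≮⇒≥ (runs-start-≮ R R′ l≤e l≤e′ e′≈e e≈e′ U′≈U))
        where
        R = run-copy (copy-sym cu) r
        R′ = run-copy (copy-sym cu′) r′
      ... | refl = same-lower b b′
        (copy-trans (copy-sym (copy-≤ (n≤1+n _) (copy-tail cu)))
                    (subst (λ e → Copy e (suc U) (suc u′)) (sym e≡e′)
                            (copy-≤ (n≤1+n _) (copy-tail cu′))))
        k< (subst (k′ <_) (sym e≡e′) k′<)
        where
        R = run-copy (copy-sym cu) r
        R′ = run-copy (copy-sym cu′) r′
        e≡e′ : m + p ≡ m′ + p′
        e≡e′ = ≤-antisym (≮⇒≥ (runs-end-≮ R′ R l≤e′ l≤e e≈e′ e′≈e refl))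
            (≮⇒≥ (runs-end-≮ R R′ l≤e l≤e′ e′≈e e≈e′ refl))

      -- U + 1 is the start of a periodic run and V + 1 + k the end of another one,
      -- where the period breaks. If the suffix at suc u continued the period for p
      -- more characters, then the suffix of the second run that is longer by p
      -- would lie strictly between the suffixes at suc u and suc v.
      clash⇒short : ∀ {u v k p U V y₁ f₁ y₂ f₂} → Boundary u v k →
        Copy (suc (suc k)) U u → Copy (suc (suc k)) V v → V + k ≤ n → 1 ≤ p → 3 * p ≤ k →
        U ≡ y₁ → Per p (suc y₁) f₁ → T y₁ ≢ T (y₁ + p) → suc U + suc k ≤ f₁ →
        suc V + k ≡ f₂ → Per p (suc y₂) f₂ → y₂ + p ≤ V → Short u k
      clash⇒short {u} {v} {k} {p} {U} {V} {f₁ = f₁} {y₂ = y₂} b cu cv V≤n 1≤p 3p≤k refl per₁ break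
          ≤f₁ refl per₂ y₂+p≤V
        with m≤n⇒∃[o]m+o≡n y₂+p≤V
      ... | d , refl = between
        where
        open Boundary b
        -- This is `V ∸ p`: the suffix at `suc y` stays in the second run for `k + p` characters.
        y = y₂ + d
        cv′ : Copy (suc k) (suc y + p) (suc v)
        cv′ = copy-tail (subst (λ w → Copy (suc (suc k)) w v) {y₂ + p + d} {y₂ + d + p}
            (y₂+p+d≡y₂+d+p y₂ p d) cv)
        p≤k : p ≤ k
        p≤k = 3*p≤k⇒p≤k p k 3p≤k
        perʸ : Per p (suc y) (suc y + (k + p))
        perʸ = per-sub {p} {suc y₂} {suc (y₂ + p + d) + k} {suc (y₂ + d)} {suc (y₂ + d) + (k + p)}
          (s≤s (m≤m+n y₂ d)) (1+[y₂+d]+[k+p]≤1+[y₂+p+d]+k y₂ d k p) per₂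
        between : Short u k
        between with short-or-periodic 1≤p 3p≤k (per-copy (copy-tail cu) (per-sub ≤-refl ≤f₁ per₁))
               (λ eq → break (trans (copy-head cu)
                       (trans eq (sym (cu p (3*p≤k⇒p<1+[1+k] p k 3p≤k))))))
        ... | inj₁ short = short
        -- Both comparisons reuse the original mismatch: the suffix at `suc y` shows the character
        -- of `suc u` after `k` characters and that of `suc v` after `k + p`.
        ... | inj₂ per = ⊥-elim (adjacent (y₂ + d) (y₂+p+d+k≤n⇒y₂+d≤n y₂ p d k n V≤n)
          (k + p , long , subst₂ _≺_ end≡ˡ end≡ʳ (proj₂ branch))
          (k , copy-trans (copy-sym (copy-≤ (m≤m+n k p) long)) copy ,
           subst (_≺ T (suc v + k)) (long k (m<m+n k 1≤p)) (proj₂ branch)))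
          where
          shuffle : ∀ a b c → a + b + c ≡ a + c + b
          shuffle a b c = y₂+p+d≡y₂+d+p a b c
          within : ∀ a {t} → t < p → a + t + p < a + (k + p)
          within a {t} t<p = t<p∧p≤k⇒a+t+p<a+[k+p] t p k a t<p p≤k
          long : Copy (k + p) (suc u) (suc y)
          long = copy-periodic {p} {k + p} {suc u} {suc y} 1≤p
            (λ t t<p → trans (copy t (≤-trans t<p p≤k))
                        (trans (sym (cv′ t (m≤n⇒m≤1+n (≤-trans t<p p≤k))))
                        (trans (cong T {suc y + p + t} {suc y + t + p} (shuffle (suc y) p t))
                          (sym (perʸ (suc y + t) (m≤m+n (suc y) t)
                            (within (suc y) t<p))))))
            (per-sub {p} {suc u} {suc u + (suc k + p)} {suc u} {suc u + (k + p)} ≤-refl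
                    (1+u+[k+p]≤1+u+[1+k+p] u k p) per) perʸ
          end≡ˡ : T (suc u + k) ≡ T (suc u + (k + p))
          end≡ˡ = trans (per (suc u + k) (m≤m+n (suc u) k) (1+u+k+p<1+u+[1+k+p] u k p))
              (cong T (+-assoc (suc u) k p))
          end≡ʳ : T (suc v + k) ≡ T (suc y + (k + p))
          end≡ʳ = trans (sym (cv′ k ≤-refl)) (cong T {suc y + p + k} {suc y + (k + p)}
              (trans (+-assoc (suc y) p k) (cong (suc y +_) (+-comm p k))))

  -- [suc y .. g + p) is a maximal interval of period p, and it contains [a .. b).
  record RunAround (p a b y g : ℕ) : Set α where
    field
      periodic   : Per p (suc y) (g + p)
      leftBreak  : T y ≢ T (y + p)
      rightBreak : T g ≢ T (g + p)
      start≤     : suc y ≤ a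
      ≤end       : b ≤ g + p

  -- A run reaching position 0 or the closing sentinel would repeat a sentinel inside the text, so
  -- both ends found by the search are genuine breaks.
  runAround : ∀ {p a e s} (R : Run p s (suc n)) → 1 ≤ p → 1 ≤ a → a ≤ s → s + p ≤ a + e →
      a + e ≤ suc n →
              Per p a (a + e) → ∃[ y ] (Run.start R ≡ suc y × RunAround p a (a + e) y (Run.last R))
  runAround {p} {a} {e} {s}
      record { start = c ; last = g ; start≤ = c≤s ; ≤last = s≤g ; periodic = perR ;
          leftBreak = breakˡ ; rightBreak = breakʳ }
            1≤p 1≤a a≤s s+p≤ ≤n+1 per
    with start-covers R per a≤s s+p≤ | last-covers R per a≤s s+p≤ (≤-trans ≤n+1 (m≤m+n (suc n) p))
    where
    R : Run p s (suc n)
    R = record { start = c ; last = g ; start≤ = c≤s ; ≤last = s≤g ; periodic = perR ;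
        leftBreak = breakˡ ; rightBreak = breakʳ }
  ... | c≤a | ≤end with breakˡ
  ...   | inj₁ refl = ⊥-elim (¬per-at-0 {p} {g + p} 1≤p
            (1≤a∧a≤s∧s+p≤a+e∧a+e≤1+n⇒p≤n a s p e n 1≤a a≤s s+p≤ ≤n+1)
            (1≤a∧a≤s∧s+p≤a+e∧a+e≤g+p⇒p<g+p a s p e g 1≤a a≤s s+p≤ ≤end) perR)
  ...   | inj₂ (y , refl , break) = y , refl , record
            { periodic = perR ; leftBreak = break ; rightBreak = end breakʳ ; start≤ = c≤a ;
                ≤end = ≤end }
    where
    end : T g ≢ T (g + p) ⊎ suc n ≤ g → T g ≢ T (g + p)
    end (inj₁ break′) = break′
    end (inj₂ n<g) = ⊥-elim (¬per-at-end {p} {suc y} {g + p} 1≤p (s≤s z≤n)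
      (1+y≤s∧s+p≤a+e∧a+e≤1+n⇒1+y+p≤1+n y s p a e n c≤s s+p≤ ≤n+1)
      (1+n≤g∧1≤p⇒1+n<g+p n g p n<g 1≤p) perR)

  -- Maximal matches, their alignments and diagonals

  record Match (U V k : ℕ) : Set α where
    field
      copy : Copy k (suc U) (suc V)
      pre≢ : T U ≢ T V
      end≢ : T (suc U + k) ≢ T (suc V + k)

  module _ {U V k g e β β′ a ε p y₁ g₁ y₂ g₂} (M : Match U V k)
           (β≡ : suc U + (g + e) ≡ β) (β′≡ : suc V + g ≡ β′) (g+e≤k : g + e ≤ k)
           (R₁ : RunAround p a β y₁ g₁) (R₂ : RunAround p β′ ε y₂ g₂)
           (1≤p : 1 ≤ p) (p≤e : p ≤ e) (a+p≤β : a + p ≤ β) (a≤ : a + e ≤ β) (ε≥ : β′ + e ≤ ε) where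
    private
      module R₁ = RunAround R₁
      module R₂ = RunAround R₂
      open Match M
      p≤g+e : p ≤ g + e
      p≤g+e = p≤e⇒p≤g+e p e g p≤e
      in₁ : suc U + (g + e) ≤ g₁ + p
      in₁ = ≤-trans (≤-reflexive β≡) R₁.≤end
      in₂ : suc V + (g + e) ≤ g₂ + p
      in₂ = ε≤g₂+p∧β′+e≤ε∧1+V+g≡β′⇒1+V+[g+e]≤g₂+p ε g₂ p β′ e V g R₂.≤end ε≥ β′≡
      g+p≤k : g + p ≤ k
      g+p≤k = p≤e∧g+e≤k⇒g+p≤k p e g k p≤e g+e≤k
      mid₁ : suc y₁ ≤ suc U + g
      mid₁ = 1+y₁≤a∧a+e≤β∧1+U+[g+e]≡β⇒1+y₁≤1+U+g y₁ a e β U g R₁.start≤ a≤ β≡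
      mid₂ : suc y₂ ≤ suc V + g
      mid₂ = ≤-trans R₂.start≤ (≤-reflexive (sym β′≡))

    -- The match aligns `β ∸ e` with `β′`. So `x` near `β` corresponds to `y` near `β′` exactly when
    -- `x + (β′ + e) ≡ y + β`, and the inequality compares the two run starts in this alignment.
    start₁ : suc y₂ + β < suc y₁ + (β′ + e) → U ≡ y₁
    start₁ lt = start-at-run copy pre≢ R₁.periodic R₂.periodic R₁.leftBreak 1≤p p≤g+e g+e≤k in₁ in₂
      (1+y₁≤a∧a+p≤β∧1+U+[g+e]≡β⇒1+y₁+p≤1+U+[g+e] y₁ a p β U g e R₁.start≤ a+p≤β β≡)
      (start₂-before-start₁ y₂ β y₁ β′ e U g V lt β≡ β′≡)

    start₂ : suc y₁ + (β′ + e) < suc y₂ + β → V ≡ y₂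
    start₂ lt = start-at-run (copy-sym copy) (pre≢ ∘ sym) R₂.periodic R₁.periodic R₂.leftBreak 1≤p
        p≤g+e g+e≤k in₂ in₁
      (1+y₂≤β′∧p≤e∧1+V+g≡β′⇒1+y₂+p≤1+V+[g+e] y₂ β′ p e V g R₂.start≤ p≤e β′≡)
      (start₁-before-start₂ y₁ β′ e y₂ β U g V lt β≡ β′≡)

    end₁ : g₁ + p + (β′ + e) < g₂ + p + β → suc U + k ≡ g₁ + p
    end₁ lt = end-at-run copy end≢ R₁.periodic R₂.periodic R₁.rightBreak 1≤p mid₁ mid₂ g+p≤k
      (1+U+[g+e]≤g₁+p∧p≤e⇒1+U+g+p≤g₁+p U g e g₁ p in₁ p≤e)
      (end₁-before-end₂ g₁ p β′ e g₂ β U g V lt β≡ β′≡)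

    end₂ : g₂ + p + β < g₁ + p + (β′ + e) → suc V + k ≡ g₂ + p
    end₂ lt = end-at-run (copy-sym copy) (end≢ ∘ sym) R₂.periodic R₁.periodic R₂.rightBreak 1≤p mid₂
        mid₁ g+p≤k
      (1+U+[g+e]≤g₁+p∧p≤e⇒1+U+g+p≤g₁+p V g e g₂ p in₂ p≤e)
      (end₂-before-end₁ g₂ p β g₁ β′ e U g V lt β≡ β′≡)

  -- On one diagonal, a match that starts later would have its preceding characters matched by the
  -- earlier one.
  match-at-diagonal : ∀ {U V k g U′ V′ k′ g′ e} → Match U V k → Match U′ V′ k′ → g + e ≤ k →
    suc U + (g + e) ≡ suc U′ + (g′ + e) → suc V + g ≡ suc V′ + g′ → ¬ U < U′
  match-at-diagonal {U} {V} {k} {g} {U′} {V′} {k′} {g′} {e} M M′ g+e≤k eqU eqV U<U′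
      with m≤n⇒∃[o]m+o≡n U<U′
  ... | t , refl = Match.pre≢ M′
          (trans (Match.copy M t (1+U+[g+e]≡1+[1+U+t]+[g′+e]∧g+e≤k⇒t<k U g e t g′ k eqU g+e≤k))
          (cong T {suc V + t} {V′} (same-offset U g e t g′ V V′ eqU eqV)))

  match-length : ∀ {U V k k′} → Match U V k → Match U V k′ → ¬ k < k′
  match-length {k = k} M M′ k<k′ = Match.end≢ M (Match.copy M′ k k<k′)

  same-diagonal : ∀ {U V k g U′ V′ k′ g′ e} → Match U V k → Match U′ V′ k′ → g + e ≤ k →
      g′ + e ≤ k′ →
    suc U + (g + e) ≡ suc U′ + (g′ + e) → suc V + g ≡ suc V′ + g′ → U ≡ U′ × k ≡ k′
  same-diagonal {U} {V} {k} {g} {U′} {V′} {k′} {g′} {e} M M′ ≤k ≤k′ eqU eqV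
    with ≤-antisym (≮⇒≥ (match-at-diagonal M′ M ≤k′ (sym eqU) (sym eqV)))
            (≮⇒≥ (match-at-diagonal M M′ ≤k eqU eqV))
  ... | refl with ≤-antisym {V} {V′} (1+U+[g+e]≡1+U+[g′+e]∧1+V+g≡1+V′+g′⇒V≤V′ U g e g′ V V′ eqU eqV)
                                     (1+U+[g+e]≡1+U+[g′+e]∧1+V+g≡1+V′+g′⇒V′≤V U g e g′ V V′ eqU eqV)
  ...   | refl = refl , ≤-antisym (≮⇒≥ (match-length M′ M)) (≮⇒≥ (match-length M M′))

  -- Both copies read the word at `b`, from starts that differ by `suc d`; so the longer copy
  -- overlaps a shift of itself.
  copies-periodic : ∀ {a a′ b e d} → Copy e a b → Copy (suc e + d) a′ b → a ≡ a′ + suc d →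
      Per (suc d) a′ (a′ + (suc e + d))
  copies-periodic {a} {a′} {b} {e} {d} c c′ refl y a′≤y y+D< with m≤n⇒∃[o]m+o≡n a′≤y
  ... | t , refl = trans (c′ t (t<e⇒t<1+e+d t e d t<e))
          (trans (sym (c t t<e)) (cong T {a′ + suc d + t} {a′ + t + suc d} (a′+1+d+t≡a′+t+1+d a′ d
                  t)))
    where
    t<e : t < e
    t<e = a′+t+1+d<a′+[1+e+d]⇒t<e a′ t d e y+D<

  -- Runs attached to a pair of phrase starts and a bucket

  leastPeriod : ∀ s e → ∃[ p ] ((1 ≤ p × Per p s e) × (∀ q → 1 ≤ q × Per q s e → p ≤ q))
  leastPeriod s e = least (λ q → (1 ≤? q) ×-dec Per? q s e) {suc e}
    -- `suc e` is a period vacuously: no pair at this distance ends before `e`.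
    (s≤s z≤n , λ y _ out →
            ⊥-elim (<-irrefl refl (≤-trans (s≤s (m≤n+m e y))
                (≤-trans (≤-reflexive (sym (+-suc y e))) (<⇒≤ out)))))

  -- The least period of the last `l` characters before `β`. The shift does not enter, so changes
  -- with the same phrase starts and bucket share the period and both runs.
  period : ℕ → ℕ → ℕ
  period β l = proj₁ (leastPeriod (β ∸ l) β)

  runˡ : ∀ β l → Run (period β l) (β ∸ l) (suc n)
  runˡ β l = run (period β l) (β ∸ l) (suc n)

  runʳ : ∀ β β′ l → Run (period β l) β′ (suc n)
  runʳ β β′ l = run (period β l) β′ (suc n)

  record KindOf (β β′ l e : ℕ) (c : Fin 6) : Set where
    constructor kindOf
    field
      is : Kind (Run.start (runˡ β l) + (β′ + e)) (Run.start (runʳ β β′ l) + β)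
                (Run.last (runˡ β l) + period β l + (β′ + e)) (Run.last (runʳ β β′ l) + period β
                        l + β) c

  kindOf? : ∀ β β′ l e → ∃ (KindOf β β′ l e)
  kindOf? β β′ l e =
    let (c , is) = kind (Run.start (runˡ β l) + (β′ + e)) (Run.start (runʳ β β′ l) + β)
                        (Run.last (runˡ β l) + period β l + (β′ + e))
                                (Run.last (runʳ β β′ l) + period β l + β)
    in c , kindOf is

  -- Two suffixes with a common prefix of length k, each replaced by a copy whose
  -- common prefix touches the phrase boundary β resp. β′. The prefix is longer by
  -- e to the left of β than to the left of β′, so T[β ∸ e .. β) = T[β′ .. β′ + e).
  record Anchored (u v k β β′ e : ℕ) : Set α where
    field
      {U V g} : ℕ
      copyᵤ : Copy (suc (suc k)) U u
      copyᵥ : Copy (suc (suc k)) V v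
      U≤n   : U + k ≤ n
      V≤n   : V + k ≤ n
      β≡    : suc U + (g + e) ≡ β
      β′≡   : suc V + g ≡ β′
      g+e≤k : g + e ≤ k

  module _ (_≺_ : Rel B ℓ) (≺-irrefl : ∀ {x y} → x ≺ y → x ≢ y) where
    open Order _≺_ ≺-irrefl

    boundary-match : ∀ {u v k β β′ e} → Boundary u v k → (A : Anchored u v k β β′ e) →
                     Match (Anchored.U A) (Anchored.V A) k
    boundary-match {u} {v} {k} b A = record
      { copy = copy-trans (copy-≤ (n≤1+n k) (copy-tail copyᵤ))
          (copy-trans copy (copy-sym (copy-≤ (n≤1+n k) (copy-tail copyᵥ))))
      ; pre≢ = λ eq → pre≢ (trans (sym (copy-head copyᵤ)) (trans eq (copy-head copyᵥ)))
      ; end≢ = λ eq → end≢ (trans (sym (copy-tail copyᵤ k ≤-refl))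
          (trans eq (copy-tail copyᵥ k ≤-refl)))
      }
      where
      open Boundary b
      open Anchored A

  core-copy : ∀ {U V k g e β′} → Match U V k → g + e ≤ k → suc V + g ≡ β′ → Copy e (suc U + g) β′
  core-copy {g = g} M g+e≤k refl = copy-shift g g+e≤k (Match.copy M)

  -- T[β ∸ e′ .. β) has the period e′ ∸ e, so the least period `p` of its last `l` characters is at
  -- most that. Both are below l / 3, hence `p` extends to all e′ characters before `β`, and through
  -- the match to those from `β′` on.
  bucket-runs : ∀ {U V k g U′ V′ k′ g′ β β′ l e e′} → Match U V k → Match U′ V′ k′ →
    suc U + (g + e) ≡ β → suc V + g ≡ β′ → g + e ≤ k →
    suc U′ + (g′ + e′) ≡ β → suc V′ + g′ ≡ β′ → g′ + e′ ≤ k′ → U′ + k′ ≤ n → V′ + k′ ≤ n →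
    e < e′ → l ≤ e → 3 * e′ < 3 * e + l →
    ∃[ y₁ ] ∃[ y₂ ] (Run.start (runˡ β l) ≡ suc y₁ × Run.start (runʳ β β′ l) ≡ suc y₂ ×
      1 ≤ period β l × period β l + e ≤ e′ ×
      RunAround (period β l) (suc U′ + g′) β y₁ (Run.last (runˡ β l)) ×
      RunAround (period β l) β′ (β′ + e′) y₂ (Run.last (runʳ β β′ l)))
  bucket-runs {U} {V} {k} {g} {U′} {V′} {k′} {g′} {β} {β′} {l} {e} {e′} M M′ β≡ β′≡ ≤k β≡′ β′≡′ ≤k′
      U′≤n V′≤n e<e′ l≤e close
    with m≤n⇒∃[o]m+o≡n e<e′ | leastPeriod (β ∸ l) β
  ... | d , refl | p , (1≤p , per) , min =
          y₁ , y₂ , start≡₁ , start≡₂ , 1≤p , p+e≤ , around₁ , around₂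
    where
    a+e≡β : suc U′ + g′ + (suc e + d) ≡ β
    a+e≡β = trans (+-assoc (suc U′) g′ (suc e + d)) β≡′
    s+l≡β : β ∸ l + l ≡ β
    s+l≡β = m∸n+n≡m {β} {l} (l≤e∧1+U+[g+e]≡β⇒l≤β l e U g β l≤e β≡)
    perD : Per (suc d) (suc U′ + g′) β
    perD = subst (Per (suc d) (suc U′ + g′)) a+e≡β
      (copies-periodic (core-copy M ≤k β′≡) (core-copy M′ ≤k′ β′≡′)
        (anchors-differ-by U g e β U′ g′ d β≡ β≡′))
    low : ∀ {s} → s + l ≡ β → suc U′ + g′ ≤ s
    low {s} s+l≡β = s+l≡β∧1+U′+[g′+[1+e+d]]≡β∧l≤e⇒1+U′+g′≤s s l β U′ g′ e d s+l≡β β≡′ l≤e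
    a′≤s : suc U′ + g′ ≤ β ∸ l
    a′≤s = low s+l≡β
    p≤D : p ≤ suc d
    p≤D = min (suc d) (s≤s z≤n , per-sub a′≤s ≤-refl perD)
    p+e≤ : p + e ≤ suc e + d
    p+e≤ = p≤1+d⇒p+e≤1+e+d p d e p≤D
    p≤l : p ≤ l
    p≤l = p≤1+d∧3*[1+e+d]<3*e+l⇒p≤l p d e l p≤D close
    room : ∀ {s} → s + l ≡ β → s + suc d + p ≤ β
    room {s} s+l≡β = s+l≡β∧p≤1+d∧3*[1+e+d]<3*e+l⇒s+1+d+p≤β s l β p d e s+l≡β p≤D close
    perA : Per p (suc U′ + g′) β
    perA = per-extend (s≤s z≤n) perD per a′≤s ≤-refl (room s+l≡β)
    β≤n+1 : β ≤ suc n
    β≤n+1 = β≤1+length U′ g′ e d β k′ n β≡′ ≤k′ U′≤n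
    β′≤n+1 : β′ + (suc e + d) ≤ suc n
    β′≤n+1 = β′+e≤1+length V′ g′ β′ e d k′ n β′≡′ ≤k′ V′≤n
    perA′ : Per p (suc U′ + g′) (suc U′ + g′ + (suc e + d))
    perA′ = subst (Per p (suc U′ + g′)) (sym a+e≡β) perA
    fits : ∀ {s} → s + l ≡ β → s + p ≤ suc U′ + g′ + (suc e + d)
    fits {s} s+l≡β = first-period-fits s l β p U′ g′ e d s+l≡β p≤l β≡′
    R₁ = runAround {p} {suc U′ + g′} {suc e + d} (run p (β ∸ l) (suc n)) 1≤p (s≤s z≤n) a′≤s
        (fits s+l≡β) (≤-trans (≤-reflexive a+e≡β) β≤n+1) perA′
    R₂ = runAround {p} {β′} {suc e + d} (run p β′ (suc n)) 1≤p (subst (1 ≤_) β′≡ (s≤s z≤n)) ≤-refl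
           (p≤l∧l≤e⇒β′+p≤β′+[1+e+d] p l e β′ d p≤l l≤e) β′≤n+1
           (per-copy (core-copy M′ ≤k′ β′≡′) perA′)
    y₁ = proj₁ R₁
    y₂ = proj₁ R₂
    start≡₁ = proj₁ (proj₂ R₁)
    start≡₂ = proj₁ (proj₂ R₂)
    around₁ : RunAround p (suc U′ + g′) β y₁ (Run.last (run p (β ∸ l) (suc n)))
    around₁ = subst (λ b → RunAround p (suc U′ + g′) b y₁ (Run.last (run p (β ∸ l) (suc n)))) a+e≡β
        (proj₂ (proj₂ R₁))
    around₂ = proj₂ (proj₂ R₂)

  -- Changes that share phrase starts and bucket

  module Injectivity (_≺_ : Rel B ℓ) (≺-irrefl : ∀ {x y} → x ≺ y → x ≢ y) where
    open Order _≺_ ≺-irrefl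

    ≻-irrefl : ∀ {x y} → y ≺ x → x ≢ y
    ≻-irrefl y≺x = ≺-irrefl y≺x ∘ sym

    module Flipped = Order (flip _≺_) ≻-irrefl

    ⊏-flip : ∀ {u v} → u ⊏ v → v Flipped.⊏ u
    ⊏-flip (k , copy , lt) = k , copy-sym copy , lt

    ⊏-unflip : ∀ {u v} → u Flipped.⊏ v → v ⊏ u
    ⊏-unflip (k , copy , lt) = k , copy-sym copy , lt

    boundary-flip : ∀ {u v k} → Boundary u v k → Flipped.Boundary v u k
    boundary-flip b = record
      { u+k≤n = v+k≤n ; v+k≤n = u+k≤n ; pre≢ = pre≢ ∘ sym
      ; branch = copy-sym (proj₁ branch) , proj₂ branch
      ; adjacent = λ x x≤n v⊏x x⊏u → adjacent x x≤n (⊏-unflip x⊏u) (⊏-unflip v⊏x)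
      }
      where open Boundary b

    module _ (compare : ∀ x y → x ≤ n → y ≤ n → suc x ⊏ suc y ⊎ (x ≡ y ⊎ suc y ⊏ suc x)) where

      compare-flip : ∀ x y → x ≤ n → y ≤ n → suc x Flipped.⊏ suc y ⊎ (x ≡ y ⊎ suc y Flipped.⊏ suc x)
      compare-flip x y x≤n y≤n with compare x y x≤n y≤n
      ... | inj₁ x⊏y        = inj₂ (inj₂ (⊏-flip x⊏y))
      ... | inj₂ (inj₁ x≡y) = inj₂ (inj₁ x≡y)
      ... | inj₂ (inj₂ y⊏x) = inj₁ (⊏-flip y⊏x)

      open Sorted compare
      module FlippedSorted = Flipped.Sorted compare-flip

      same-copy : ∀ {u v k u′ v′ k′ U U′ f} → Boundary u v k → Boundary u′ v′ k′ →
                  Copy (suc (suc k)) U u → Copy (suc (suc k′)) U′ u′ → U ≡ U′ → suc U + k ≡ f →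
                      suc U′ + k′ ≡ f → u ≡ u′
      same-copy {k = k} {k′ = k′} {U = U} b b′ c c′ refl end end′
        with +-cancelˡ-≡ (suc U) k k′ (trans end (sym end′))
      ... | refl = same-lower b b′ (copy-trans (copy-sym (copy-tail c)) (copy-tail c′)) ≤-refl
              ≤-refl

      same-copy-flip : ∀ {u v k u′ v′ k′ V V′ f} → Boundary u v k → Boundary u′ v′ k′ →
                       Copy (suc (suc k)) V v → Copy (suc (suc k′)) V′ v′ → V ≡ V′ → suc V + k ≡ f →
                           suc V′ + k′ ≡ f → v ≡ v′
      same-copy-flip {k = k} {k′ = k′} {V = V} b b′ c c′ refl end end′
        with +-cancelˡ-≡ (suc V) k k′ (trans end (sym end′))
      ... | refl = FlippedSorted.same-lower (boundary-flip b) (boundary-flip b′)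
              (copy-trans (copy-sym (copy-tail c)) (copy-tail c′)) ≤-refl ≤-refl

      anchored-≡ : ∀ {u v k u′ v′ k′ β β′ e} → Boundary u v k → Boundary u′ v′ k′ →
        Anchored u v k β β′ e → Anchored u′ v′ k′ β β′ e → u ≡ u′
      anchored-≡ b b′ A A′
        with same-diagonal (boundary-match _≺_ ≺-irrefl b A) (boundary-match _≺_ ≺-irrefl b′ A′)
               A.g+e≤k A′.g+e≤k (trans A.β≡ (sym A′.β≡)) (trans A.β′≡ (sym A′.β′≡))
        where
        module A = Anchored A
        module A′ = Anchored A′
      ... | U≡U′ , k≡k′ = same-copy b b′ (Anchored.copyᵤ A) (Anchored.copyᵤ A′) U≡U′
        (cong₂ (λ U k → suc U + k) U≡U′ k≡k′) refl

      anchored-< : ∀ {u v k u′ v′ k′ β β′ l e e′ c} → Boundary u v k → Boundary u′ v′ k′ →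
        Anchored u v k β β′ e → Anchored u′ v′ k′ β β′ e′ →
        ¬ Short v k → ¬ Short u′ k′ →
        e < e′ → l ≤ e → 3 * e′ < 3 * e + l → KindOf β β′ l e c → KindOf β β′ l e′ c →
        u ≡ u′ ⊎ v ≡ v′
      anchored-< {u} {v} {k} {u′} {v′} {k′} {β} {β′} {l} {e} {e′} {c} b b′
        A@record { U = U ; V = V ; g = g ; copyᵤ = copyᵤ ; copyᵥ = copyᵥ
                 ; U≤n = U≤n ; V≤n = V≤n ; β≡ = β≡ ; β′≡ = β′≡ ; g+e≤k = ≤k }
        A′@record { U = U′ ; V = V′ ; g = g′ ; copyᵤ = copyᵤ′ ; copyᵥ = copyᵥ′
                  ; U≤n = U′≤n ; V≤n = V′≤n ; β≡ = β≡′ ; β′≡ = β′≡′ ; g+e≤k = ≤k′ }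
        ¬short ¬short′ e<e′ l≤e close (kindOf κ) (kindOf κ′) =
        go (boundary-match _≺_ ≺-irrefl b A) (boundary-match _≺_ ≺-irrefl b′ A′)
           (Run.start (runˡ β l)) (Run.start (runʳ β β′ l)) (Run.last (runˡ β l))
                   (Run.last (runʳ β β′ l)) (period β l)
           (bucket-runs (boundary-match _≺_ ≺-irrefl b A) (boundary-match _≺_ ≺-irrefl b′ A′)
             β≡ β′≡ ≤k β≡′ β′≡′ ≤k′ U′≤n V′≤n e<e′ l≤e close) c κ κ′
        where
        go : Match U V k → Match U′ V′ k′ → ∀ s₁ s₂ g₁ g₂ p →
             ∃[ y₁ ] ∃[ y₂ ] (s₁ ≡ suc y₁ × s₂ ≡ suc y₂ × 1 ≤ p × p + e ≤ e′ ×
               RunAround p (suc U′ + g′) β y₁ g₁ × RunAround p β′ (β′ + e′) y₂ g₂) →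
             ∀ c → Kind (s₁ + (β′ + e)) (s₂ + β) (g₁ + p + (β′ + e)) (g₂ + p + β) c →
             Kind (s₁ + (β′ + e′)) (s₂ + β) (g₁ + p + (β′ + e′)) (g₂ + p + β) c → u ≡ u′ ⊎ v ≡ v′
        go M M′ s₁ s₂ g₁ g₂ p (y₁ , y₂ , refl , refl , 1≤p , p+e≤e′ , R₁ , R₂) = by-kind
          where
          p≤e : p ≤ e
          p≤e = p+e≤e′∧3*e′<3*e+l∧l≤e⇒p≤e p e e′ l p+e≤e′ close l≤e
          p≤e′ : p ≤ e′
          p≤e′ = ≤-trans p≤e (<⇒≤ e<e′)
          3p≤k : 3 * p ≤ k
          3p≤k = p+e≤e′∧3*e′<3*e+l∧l≤e∧g+e≤k⇒3*p≤k p e e′ l g k p+e≤e′ close l≤e ≤k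
          3p≤k′ : 3 * p ≤ k′
          3p≤k′ = p+e≤e′∧3*e′<3*e+l∧l≤e∧g′+e′≤k′⇒3*p≤k′ p e e′ l g′ k′ p+e≤e′ close l≤e ≤k′
          a+p≤β : suc U′ + g′ + p ≤ β
          a+p≤β = p≤e′∧1+U′+[g′+e′]≡β⇒1+U′+g′+p≤β p e′ U′ g′ β p≤e′ β≡′
          a+e≤β : suc U′ + g′ + e ≤ β
          a+e≤β = e<e′∧1+U′+[g′+e′]≡β⇒1+U′+g′+e≤β e e′ U′ g′ β e<e′ β≡′
          a+e′≤β : suc U′ + g′ + e′ ≤ β
          a+e′≤β = 1+U′+[g′+e′]≡β⇒1+U′+g′+e′≤β U′ g′ e′ β β≡′
          β′+e≤ : β′ + e ≤ β′ + e′
          β′+e≤ = +-monoʳ-≤ β′ (<⇒≤ e<e′)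

          module R₁ = RunAround R₁
          module R₂ = RunAround R₂
          U≡ = start₁ M β≡ β′≡ ≤k R₁ R₂ 1≤p p≤e a+p≤β a+e≤β β′+e≤
          U≡′ = start₁ M′ β≡′ β′≡′ ≤k′ R₁ R₂ 1≤p p≤e′ a+p≤β a+e′≤β ≤-refl
          V≡ = start₂ M β≡ β′≡ ≤k R₁ R₂ 1≤p p≤e a+p≤β a+e≤β β′+e≤
          V≡′ = start₂ M′ β≡′ β′≡′ ≤k′ R₁ R₂ 1≤p p≤e′ a+p≤β a+e′≤β ≤-refl
          endᵤ = end₁ M β≡ β′≡ ≤k R₁ R₂ 1≤p p≤e a+p≤β a+e≤β β′+e≤
          endᵤ′ = end₁ M′ β≡′ β′≡′ ≤k′ R₁ R₂ 1≤p p≤e′ a+p≤β a+e′≤β ≤-refl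
          endᵥ = end₂ M β≡ β′≡ ≤k R₁ R₂ 1≤p p≤e a+p≤β a+e≤β β′+e≤
          endᵥ′ = end₂ M′ β≡′ β′≡′ ≤k′ R₁ R₂ 1≤p p≤e′ a+p≤β a+e′≤β ≤-refl

          by-kind : ∀ c → Kind (suc y₁ + (β′ + e)) (suc y₂ + β) (g₁ + p + (β′ + e)) (g₂ + p + β) c →
                    Kind (suc y₁ + (β′ + e′)) (suc y₂ + β) (g₁ + p + (β′ + e′)) (g₂ + p + β) c →
                        u ≡ u′ ⊎ v ≡ v′
          -- Runs aligned at one end determine the shift, but the two shifts differ.
          by-kind 0F x≡y x≡y′ =
              ⊥-elim (<⇒≢ e<e′ (+-cancelˡ-≡ β′ e e′ (+-cancelˡ-≡ (suc y₁) _ _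
                  (trans x≡y (sym x≡y′)))))
          by-kind 1F s≡t s≡t′ =
              ⊥-elim (<⇒≢ e<e′ (+-cancelˡ-≡ β′ e e′ (+-cancelˡ-≡ (g₁ + p) _ _
                  (trans s≡t (sym s≡t′)))))
          -- Both matches start and end with the first run, so the copies of the two lower prefixes
          -- coincide.
          by-kind 2F (y<x , s<t) (y<x′ , s<t′) =
            inj₁ (same-copy b b′ copyᵤ copyᵤ′ (trans (U≡ y<x) (sym (U≡′ y<x′))) (endᵤ s<t)
                    (endᵤ′ s<t′))
          by-kind 3F (x<y , t<s) (x<y′ , t<s′) =
            inj₂ (same-copy-flip b b′ copyᵥ copyᵥ′ (trans (V≡ x<y) (sym (V≡′ x<y′))) (endᵥ t<s)
                    (endᵥ′ t<s′))
          -- The match starts with the first run and ends with the second. At the larger shift `e′`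
          -- the second run begins at least `p` before the match, which is the room that
          -- `clash⇒short` needs.
          by-kind 4F (y<x , t<s) (y<x′ , t<s′) =
              ⊥-elim (¬short′ (clash⇒short b′ copyᵤ′ copyᵥ′ V′≤n 1≤p 3p≤k′
            (U≡′ y<x′) R₁.periodic R₁.leftBreak (below β≡′ β′≡′ (endᵥ′ t<s′) t<s′)
            (endᵥ′ t<s′) R₂.periodic (before (U≡ y<x) (U≡′ y<x′) y<x)))
            where
            below : suc U′ + (g′ + e′) ≡ β → suc V′ + g′ ≡ β′ → suc V′ + k′ ≡ g₂ + p →
                    g₂ + p + β < g₁ + p + (β′ + e′) → suc U′ + suc k′ ≤ g₁ + p
            below β≡ β′≡ end lt = prefix-inside-run₁ V′ k′ g₂ p β g₁ β′ e′ U′ g′ end lt β≡ β′≡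
            before : U ≡ y₁ → U′ ≡ y₁ → suc y₂ + β < suc y₁ + (β′ + e) → y₂ + p ≤ V′
            before U≡y U′≡y lt = longer-suffix-inside-run₂ U′ y₁ y₂ β β′ e g′ e′ V′ p U′≡y lt β≡′
                β′≡′ p+e≤e′
          -- In the reversed order the runs exchange roles, and now the smaller shift `e` has the
          -- room of `p`.
          by-kind 5F (x<y , s<t) (x<y′ , s<t′) =
              ⊥-elim (¬short (FlippedSorted.clash⇒short (boundary-flip b) copyᵥ copyᵤ U≤n 1≤p 3p≤k
            (V≡ x<y) R₂.periodic R₂.leftBreak (below (endᵤ s<t) s<t)
            (endᵤ s<t) R₁.periodic (before (V≡ x<y) x<y′)))
            where
            below : suc U + k ≡ g₁ + p → g₁ + p + (β′ + e) < g₂ + p + β → suc V + suc k ≤ g₂ + p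
            below end lt = prefix-inside-run₂ U k g₁ p β′ e g₂ β g V end lt β≡ β′≡
            before : V ≡ y₂ → suc y₁ + (β′ + e′) < suc y₂ + β → y₁ + p ≤ U
            before V≡y lt = longer-suffix-inside-run₁ V y₂ y₁ β′ e′ β U g e p V≡y lt β≡ β′≡ p+e≤e′

  -- Encoding the changes

  module Coding (_≺_ : Rel B ℓ) (≺-irrefl : ∀ {x y} → x ≺ y → x ≢ y) 
                (Z : ℕ) (start : Fin Z → ℕ) where
    open Order _≺_ ≺-irrefl
    module I = Injectivity _≺_ ≺-irrefl
    module J = Injectivity (flip _≺_) I.≻-irrefl

    module _ (compare : ∀ x y → x ≤ n → y ≤ n → suc x ⊏ suc y ⊎ (x ≡ y ⊎ suc y ⊏ suc x))
             (crossing : ∀ s m → 1 ≤ m → s + m ≤ suc n →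
                ∃[ s′ ] (Copy (suc m) s′ s × s′ + m ≤ suc n ×
                    ∃[ j ] (s′ < start j × start j ≤ s′ + m)))
             (L : ℕ) (n<2^L : n < 2 ^ L) where

      -- In the first summand `Fin 1` stands for equal reach to the left, and `Fin 2` tells which
      -- copy reaches further; the bucket of the excess and the kind follow. In the second, `Fin 2`
      -- tells whether the lower or the upper suffix is short, and `Fin 10` is a slot.
      Code : Set
      Code = (Fin Z × Fin Z × (Fin 1 ⊎ (Fin 2 × (Fin L × Fin 3) × Fin 6))) ⊎
             (Fin 2 × Fin Z × (Fin L × Fin 3) × Fin 10)

      -- As `x ≤ m + p < 2 * octave b`, ten slots of a fifth of an octave suffice. With a common
      -- phrase start, equal slots put two run starts within that distance.
      record ShortAnchored (u k : ℕ) (j : Fin Z) (b : Fin L × Fin 3) (q : Fin 10) : Set α where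
        field
          {p m U x} : ℕ
          short  : ShortRun u k p m
          copy   : Copy (suc (suc (m + p))) U u
          β≡     : suc U + x ≡ start j
          inside : InBucket b (m + p)
          slot≤  : toℕ q * octave b ≤ 5 * x
          <slot  : 5 * x < toℕ q * octave b + octave b

      -- When two `shifted` changes are compared, the one with the smaller shift supplies
      -- `¬ Short v k` and the other `¬ Short u k`, so each change carries both.
      data HasCode (u v k : ℕ) : Code → Set α where
        aligned : ∀ {j j′} → ¬ Short u k → ¬ Short v k → Anchored u v k (start j) (start j′) 0 →
                  HasCode u v k (inj₁ (j , j′ , inj₁ 0F))
        shifted : ∀ {j j′ b c e} → ¬ Short u k → ¬ Short v k → Anchored u v k (start j) (start j′)
            e →
                  InBucket b e → KindOf (start j) (start j′) (octave b) e c →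
                  HasCode u v k (inj₁ (j , j′ , inj₂ (0F , b , c)))
        shifted′ : ∀ {j j′ b c e} → ¬ Short v k → ¬ Short u k → Anchored v u k (start j) (start j′)
            e →
                  InBucket b e → KindOf (start j) (start j′) (octave b) e c →
                  HasCode u v k (inj₁ (j , j′ , inj₂ (1F , b , c)))
        lower : ∀ {j b q} → ShortAnchored u k j b q → HasCode u v k (inj₂ (0F , j , b , q))
        upper : ∀ {j b q} → ShortAnchored v k j b q → HasCode u v k (inj₂ (1F , j , b , q))

      shortAnchored : ∀ {u k} → u + k ≤ n → Short u k → ∃[ j ] ∃[ b ] ∃[ q ] ShortAnchored u k j b q
      shortAnchored {u} {k} u+k≤n (p , _ , m , _ , short@(_ , _ , run)) =
        let U , copy , fits , j , U<β , β≤ =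
                crossing u (suc (m + p)) (s≤s z≤n) (shortRun-fits u+k≤n short)
            x , β≡ = m≤n⇒∃[o]m+o≡n U<β
            b , inside , e<2l = bucket {L} {m + p} (≤-trans (MaximalRun.1≤p run) (m≤n+m p m))
                (<-≤-trans (s≤s (shrink U fits)) n<2^L)
            q , slot≤ , <slot = position b (≤-trans (≤-reflexive β≡) β≤) e<2l
        in j , b , q , record { short = short ; copy = copy ; β≡ = β≡ ; inside = inside ;
                slot≤ = slot≤ ; <slot = <slot }
        where
        shrink : ∀ U {e} → U + suc e ≤ suc n → e ≤ n
        shrink U {e} fits = U+1+e≤1+n⇒e≤n U e n fits
        position : ∀ b {U x e} → suc U + x ≤ U + suc e → e < 2 * octave b →
                   ∃[ q ] (toℕ {10} q * octave b ≤ 5 * x × 5 * x < toℕ q * octave b + octave b)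
        position b {U} {x} {e} x≤e e<2l = slot 10 (5 * x) (octave b) (bound {octave b} x≤e e<2l)
          where
          bound : ∀ {l} → suc U + x ≤ U + suc e → e < 2 * l → 5 * x < 10 * l
          bound {l} x≤e e<2l = 1+U+x≤U+1+e∧e<2*l⇒5*x<10*l U x e l x≤e e<2l

      -- The copied window has `k + 2` characters: it includes those before and after the common
      -- prefix, hence both mismatches.
      anchor : ∀ {u k} → u + k ≤ n → ∃[ U ] ∃[ j ] ∃[ x ] (Copy (suc (suc k)) U u × U + k ≤ n ×
          suc U + x ≡ start j × x ≤ k)
      anchor {u} {k} u+k≤n =
        let U , copy , fits , j , U<β , β≤ =
                crossing u (suc k) (s≤s z≤n) (≤-trans (≤-reflexive (+-suc u k)) (s≤s u+k≤n))
            x , β≡ = m≤n⇒∃[o]m+o≡n U<β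
        in U , j , x , copy , ≤-pred (≤-trans (≤-reflexive (sym (+-suc U k))) fits) , β≡ ,
                bound (≤-trans (≤-reflexive β≡) β≤)
        where
        bound : ∀ {U x} → suc U + x ≤ U + suc k → x ≤ k
        bound {U} {x} x≤ = 1+U+x≤U+1+k⇒x≤k U x k x≤

      anchored : ∀ {u v k U V x x′ j j′} → Copy (suc (suc k)) U u → Copy (suc (suc k)) V v →
          U + k ≤ n → V + k ≤ n →
                 suc U + x ≡ start j → suc V + x′ ≡ start j′ → x ≤ k → ∀ e → x′ + e ≡ x →
                     Anchored u v k (start j) (start j′) e
      anchored cu cv U≤n V≤n β≡ β′≡ x≤k e refl = record
        { copyᵤ = cu ; copyᵥ = cv ; U≤n = U≤n ; V≤n = V≤n ; β≡ = β≡ ; β′≡ = β′≡ ; g+e≤k = x≤k }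

      shift-bucket : ∀ {U k x x′} e → U + k ≤ n → x ≤ k → x′ + suc e ≡ x →
          ∃[ b ] InBucket {L} b (suc e)
      shift-bucket {U} {k} {x} {x′} e U≤n x≤k eq =
        let b , inside , _ = bucket {L} {suc e} (s≤s z≤n) (<-≤-trans (s≤s e<n) n<2^L)
        in b , inside
        where
        e<n : suc e ≤ n
        e<n = x′+1+e≡x∧x≤k∧U+k≤n⇒1+e≤n x′ e x k U n eq x≤k U≤n

      difference : ∀ x x′ → (∃[ e ] x′ + e ≡ x) ⊎ (∃[ e ] x + e ≡ x′)
      difference x x′ with ≤-total x′ x
      ... | inj₁ x′≤x = inj₁ (m≤n⇒∃[o]m+o≡n x′≤x)
      ... | inj₂ x≤x′ = inj₂ (m≤n⇒∃[o]m+o≡n x≤x′)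

      hasCode : ∀ {u v k} → Boundary u v k → ∃ (HasCode u v k)
      hasCode {u} {v} {k} bd = by-shortness (Short? u k) (Short? v k)
        where
        open Boundary bd using (u+k≤n; v+k≤n)
        by-shortness : Dec (Short u k) → Dec (Short v k) → ∃ (HasCode u v k)
        by-shortness (yes short) _ =
          let _ , _ , _ , s = shortAnchored u+k≤n short in _ , lower s
        by-shortness (no _) (yes short) =
          let _ , _ , _ , s = shortAnchored v+k≤n short in _ , upper s
        by-shortness (no ¬u) (no ¬v) =
          let U , j , x , cu , U≤n , β≡ , x≤k = anchor u+k≤n
              V , j′ , x′ , cv , V≤n , β′≡ , x′≤k = anchor v+k≤n
          in by-shift U V x x′ j j′ cu cv U≤n V≤n β≡ β′≡ x≤k x′≤k (difference x x′)
          where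
          by-shift : ∀ U V x x′ j j′ → Copy (suc (suc k)) U u → Copy (suc (suc k)) V v → U + k ≤ n →
              V + k ≤ n →
                     suc U + x ≡ start j → suc V + x′ ≡ start j′ → x ≤ k → x′ ≤ k →
                     (∃[ e ] x′ + e ≡ x) ⊎ (∃[ e ] x + e ≡ x′) → ∃ (HasCode u v k)
          by-shift U V x x′ j j′ cu cv U≤n V≤n β≡ β′≡ x≤k x′≤k (inj₁ (zero , eq)) =
            _ , aligned ¬u ¬v (anchored {j = j} {j′} cu cv U≤n V≤n β≡ β′≡ x≤k 0 eq)
          by-shift U V x x′ j j′ cu cv U≤n V≤n β≡ β′≡ x≤k x′≤k (inj₁ (suc e , eq)) =
            let b , inside = shift-bucket {x′ = x′} e U≤n x≤k eq
                c , κ = kindOf? (start j) (start j′) (octave b) (suc e)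
            in _ , shifted ¬u ¬v (anchored {j = j} {j′} cu cv U≤n V≤n β≡ β′≡ x≤k (suc e) eq) inside
                    κ
          by-shift U V x x′ j j′ cu cv U≤n V≤n β≡ β′≡ x≤k x′≤k (inj₂ (zero , eq)) =
            _ , aligned ¬u ¬v (anchored {j = j} {j′} cu cv U≤n V≤n β≡ β′≡ x≤k 0
              (trans (+-identityʳ x′) (trans (sym eq) (+-identityʳ x))))
          by-shift U V x x′ j j′ cu cv U≤n V≤n β≡ β′≡ x≤k x′≤k (inj₂ (suc e , eq)) =
            let b , inside = shift-bucket {x′ = x} e V≤n x′≤k eq
                c , κ = kindOf? (start j′) (start j) (octave b) (suc e)
            in _ , shifted′ ¬v ¬u (anchored {j = j′} {j} cv cu V≤n U≤n β′≡ β≡ x′≤k (suc e) eq)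
                    inside κ

      starts-close : ∀ {u k u′ k′ j b q} (s : ShortAnchored u k j b q) (s′ : ShortAnchored u′ k′ j b
          q) →
                     5 * ShortAnchored.U s′ < 5 * ShortAnchored.U s + octave b
      starts-close {j = j} {b} {q} s s′ =
          close {S.U} {S.x} {S′.U} {S′.x} {toℕ q * octave b} {octave b} (trans S.β≡ (sym S′.β≡))
              S.<slot S′.slot≤
        where
        module S = ShortAnchored s
        module S′ = ShortAnchored s′
        close : ∀ {U x U′ x′ w l} → suc U + x ≡ suc U′ + x′ → 5 * x < w + l → w ≤ 5 * x′ →
            5 * U′ < 5 * U + l
        close {U} {x} {U′} {x′} {w} {l} eq x< w≤x′ =
            1+U+x≡1+U′+x′∧5*x<w+l∧w≤5*x′⇒5*U′<5*U+l U x U′ x′ w l eq x< w≤x′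

      -- Either equality identifies the change, since each suffix has one successor and one
      -- predecessor in the order.
      hasCode-inj : ∀ {u v k u′ v′ k′ c} → Boundary u v k → Boundary u′ v′ k′ →
                    HasCode u v k c → HasCode u′ v′ k′ c → u ≡ u′ ⊎ v ≡ v′
      hasCode-inj b b′ (aligned _ _ a) (aligned _ _ a′) = inj₁ (I.anchored-≡ compare b b′ a a′)
      hasCode-inj b b′ (shifted {b = bkt} {e = e} ¬su ¬sv a i κ) (shifted {e = e′} ¬su′ ¬sv′ a′ i′
          κ′) with <-cmp e e′
      ... | tri< e<e′ _ _ =
              I.anchored-< compare {l = octave bkt} b b′ a a′ ¬sv ¬su′ e<e′ (InBucket.octave≤ i)
                  (bucket-close bkt i i′) κ κ′
      ... | tri≈ _ refl _ = inj₁ (I.anchored-≡ compare b b′ a a′)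
      ... | tri> _ _ e′<e = [ inj₁ ∘ sym , inj₂ ∘ sym ]′
            (I.anchored-< compare {l = octave bkt} b′ b a′ a ¬sv′ ¬su e′<e (InBucket.octave≤ i′)
                    (bucket-close bkt i′ i) κ′ κ)
      -- In the reversed order `v` is the lower suffix, so the two alternatives are swapped back.
      hasCode-inj b b′ (shifted′ {b = bkt} {e = e} ¬sv ¬su a i κ) (shifted′ {e = e′} ¬sv′ ¬su′ a′ i′
          κ′) with <-cmp e e′
      ... | tri< e<e′ _ _ = [ inj₂ , inj₁ ]′
            (J.anchored-< (I.compare-flip compare) {l = octave bkt} (I.boundary-flip b)
                    (I.boundary-flip b′) a a′ ¬su ¬sv′ e<e′ (InBucket.octave≤ i)
                            (bucket-close bkt i i′) κ κ′)
      ... | tri≈ _ refl _ =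
              inj₂ (J.anchored-≡ (I.compare-flip compare) (I.boundary-flip b) (I.boundary-flip b′) a
                      a′)
      ... | tri> _ _ e′<e = [ inj₂ ∘ sym , inj₁ ∘ sym ]′
            (J.anchored-< (I.compare-flip compare) {l = octave bkt} (I.boundary-flip b′)
                    (I.boundary-flip b) a′ a ¬su′ ¬sv e′<e (InBucket.octave≤ i′)
                            (bucket-close bkt i′ i) κ′ κ)
      hasCode-inj b b′ (lower {b = bkt} s) (lower s′) =
          inj₁ (Sorted.short-inj compare {l = octave bkt} b b′ S.short S′.short S.copy S′.copy
          (InBucket.octave≤ S.inside) (InBucket.octave≤ S′.inside) (bucket-close bkt S.inside
                  S′.inside) (bucket-close bkt S′.inside S.inside)
          (starts-close s s′) (starts-close s′ s))
        where
        module S = ShortAnchored s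
        module S′ = ShortAnchored s′
      hasCode-inj b b′ (upper {b = bkt} s) (upper s′) =
          inj₂ (I.FlippedSorted.short-inj compare {l = octave bkt} (I.boundary-flip b)
                  (I.boundary-flip b′)
          S.short S′.short S.copy S′.copy
          (InBucket.octave≤ S.inside) (InBucket.octave≤ S′.inside) (bucket-close bkt S.inside
                  S′.inside) (bucket-close bkt S′.inside S.inside)
          (starts-close s s′) (starts-close s′ s))
        where
        module S = ShortAnchored s
        module S′ = ShortAnchored s′

-- Counting the runs of the transform

module Counting {A : Set α} {_≺_ : Rel (Maybe A) ℓ} (≺-sto : IsStrictTotalOrder _≡_ _≺_)
                (S : List A) (Fs : List (List A)) (lz : IsLZ77 S Fs)
                (π : Permutation′ (suc (length S))) (sorted : SortsRotations _≺_ S π) where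
  open IsStrictTotalOrder ≺-sto using (_≟_; irrefl; asym)
  open Phrases S Fs lz

  T : ℕ → Maybe A
  T = S ⟦_⟧

  n z : ℕ
  n = length S
  z = length Fs

  T≢$ : ∀ y → 1 ≤ y → y ≤ n → T y ≢ nothing
  T≢$ (suc y) _ y<n = at-just S y<n

  ≺-irrefl : ∀ {x y} → x ≺ y → x ≢ y
  ≺-irrefl x≺y x≡y = irrefl x≡y x≺y

  open Text _≟_ T nothing n refl (at-length S) T≢$
  open Order _≺_ ≺-irrefl
  module C = Coding _≺_ ≺-irrefl (suc z) (start ∘ toℕ)

  ⊏-asym : ∀ u v → u ⊏ v → ¬ v ⊏ u
  ⊏-asym u v (k , copy , u≺v) (k′ , copy′ , v≺u) with <-cmp k k′
  ... | tri< k<k′ _ _ = ≺-irrefl u≺v (sym (copy′ k k<k′))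
  ... | tri≈ _ refl _ = asym u≺v v≺u
  ... | tri> _ _ k′<k = ≺-irrefl v≺u (sym (copy k′ k′<k))

  ⊏-irrefl : ∀ u → ¬ u ⊏ u
  ⊏-irrefl u u⊏u = ⊏-asym u u u⊏u u⊏u

  pos : Fin (suc n) → ℕ
  pos i = toℕ (π ⟨$⟩ʳ i)

  pos≤n : ∀ i → pos i ≤ n
  pos≤n i = ≤-pred (Fin.toℕ<n (π ⟨$⟩ʳ i))

  pos-injective : ∀ {i j} → pos i ≡ pos j → i ≡ j
  pos-injective {i} {j} eq =
    trans (sym (inverseˡ π)) (trans (cong (π ⟨$⟩ˡ_) (Fin.toℕ-injective eq)) (inverseˡ π))

  pos-surjective : ∀ x → x ≤ n → ∃[ i ] pos i ≡ x
  pos-surjective x x≤n =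
      π ⟨$⟩ˡ (fromℕ< (s≤s x≤n)) , trans (cong toℕ (inverseʳ π)) (Fin.toℕ-fromℕ< (s≤s x≤n))

  sorted-branch : ∀ {i j} → i Fin.< j → ∃[ k ] (pos i + k ≤ n × pos j + k ≤ n ×
      Branch k (suc (pos i)) (suc (pos j)))
  sorted-branch {i} {j} i<j with lex⇒branch (drop (pos i) S) (drop (pos j) S) lengths≢ (sorted i<j)
    where
    lengths≢ : length (drop (pos i) S) ≢ length (drop (pos j) S)
    lengths≢ eq = Fin.<-irrefl (pos-injective (∸-cancelˡ-≡ (pos≤n i) (pos≤n j)
      (trans (sym (length-drop (pos i) S)) (trans eq (length-drop (pos j) S))))) i<j
  ... | k , k≤i , k≤j , copy , branch = k , fits i k≤i , fits j k≤j ,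
        (λ t t<k → trans (sym (at-drop S (pos i) t)) (trans (copy t t<k) (at-drop S (pos j) t))) ,
        subst₂ _≺_ (at-drop S (pos i) k) (at-drop S (pos j) k) branch
    where
    fits : ∀ i → k ≤ length (drop (pos i) S) → pos i + k ≤ n
    fits i k≤ = ≤-trans (+-monoʳ-≤ (pos i) (≤-trans k≤ (≤-reflexive (length-drop (pos i) S))))
                        (≤-reflexive (m+[n∸m]≡n (pos≤n i)))

  sorted⇒⊏ : ∀ {i j} → i Fin.< j → suc (pos i) ⊏ suc (pos j)
  sorted⇒⊏ i<j with sorted-branch i<j
  ... | k , _ , _ , branch = k , branch

  compare : ∀ x y → x ≤ n → y ≤ n → suc x ⊏ suc y ⊎ (x ≡ y ⊎ suc y ⊏ suc x)
  compare x y x≤n y≤n with pos-surjective x x≤n | pos-surjective y y≤n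
  ... | i , refl | j , refl with Fin.<-cmp i j
  ...   | tri< i<j _ _ = inj₁ (sorted⇒⊏ i<j)
  ...   | tri≈ _ i≡j _ = inj₂ (inj₁ (cong pos i≡j))
  ...   | tri> _ _ j<i = inj₂ (inj₂ (sorted⇒⊏ j<i))

  nothing-between : ∀ i x → x ≤ n → suc (pos (Fin.inject₁ i)) ⊏ suc x →
      suc x ⊏ suc (pos (Fin.suc i)) → ⊥
  nothing-between i x x≤n below above with pos-surjective x x≤n
  ... | j , refl with Fin.<-cmp j (Fin.suc i)
  ...   | tri≈ _ refl _ = ⊏-irrefl (suc (pos j)) above
  ...   | tri> _ _ i+1<j = ⊏-asym (suc (pos j)) (suc (pos (Fin.suc i))) above (sorted⇒⊏ i+1<j)
  ...   | tri< j<i+1 _ _ with Fin.<-cmp j (Fin.inject₁ i)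
  ...     | tri< j<i _ _ = ⊏-asym (suc (pos (Fin.inject₁ i))) (suc (pos j)) below (sorted⇒⊏ j<i)
  ...     | tri≈ _ refl _ = ⊏-irrefl (suc (pos j)) below
  ...     | tri> _ _ i<j =
          <-irrefl refl (≤-trans (≤-trans (s≤s (≤-reflexive (sym (Fin.toℕ-inject₁ i)))) i<j)
              (≤-pred j<i+1))

  boundary : ∀ i → T (pos (Fin.inject₁ i)) ≢ T (pos (Fin.suc i)) →
      ∃ (Boundary (pos (Fin.inject₁ i)) (pos (Fin.suc i)))
  boundary i ≢ with sorted-branch {Fin.inject₁ i} {Fin.suc i}
      (s≤s (≤-reflexive (Fin.toℕ-inject₁ i)))
  ... | k , u+k≤n , v+k≤n , branch = k , record
    { u+k≤n = u+k≤n ; v+k≤n = v+k≤n ; pre≢ = ≢ ; branch = branch ; adjacent = nothing-between i }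

  codes : ℕ → ℕ → ℕ
  codes Z L = Z * (Z * (1 + 2 * ((L * 3) * 6))) + 2 * (Z * ((L * 3) * 10))

  code↔ : ∀ L n<2^L → Fin (codes (suc z) L) ↔ C.Code compare crossing L n<2^L
  code↔ L _ = (↔-id _ ⊠
      (↔-id _ ⊠ (↔-id (Fin 1) ⊞ (↔-id (Fin 2) ⊠ ((↔-id (Fin L) ⊠ ↔-id (Fin 3)) ⊠ ↔-id (Fin 6)))))) ⊞
              (↔-id (Fin 2) ⊠ (↔-id _ ⊠ ((↔-id (Fin L) ⊠ ↔-id (Fin 3)) ⊠ ↔-id (Fin 10))))

  runs≤ : ∀ L → n < 2 ^ L → runs _≟_ (bwt S π) ≤ suc (codes (suc z) L)
  runs≤ L n<2^L with derun-changes _≟_ (T ∘ pos)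
  ... | m , h , h-inj , change , len =
          ≤-trans (≤-reflexive len) (s≤s (Fin.injective⇒≤ {f = code} code-inj))
    where
    bd : ∀ i → ∃ (Boundary (pos (Fin.inject₁ (h i))) (pos (Fin.suc (h i))))
    bd i = boundary (h i) (change i)
    hasCode : ∀ i → ∃ (C.HasCode compare crossing L n<2^L _ _ _)
    hasCode i = C.hasCode compare crossing L n<2^L (proj₂ (bd i))
    code : Fin m → Fin (codes (suc z) L)
    code i = Inverse.from (code↔ L n<2^L) (proj₁ (hasCode i))
    code-inj : Injective _≡_ _≡_ code
    code-inj {i} {j} eq =
        h-inj ([ (λ u≡ → Fin.inject₁-injective (pos-injective u≡)) ,
            (λ v≡ → Fin.suc-injective (pos-injective v≡)) ]′
      (C.hasCode-inj compare crossing L n<2^L (proj₂ (bd i)) (proj₂ (bd j)) (proj₂ (hasCode i))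
        (subst (C.HasCode compare crossing L n<2^L _ _ _) (sym (from-injective (code↔ L n<2^L) eq))
                (proj₂ (hasCode j)))))

-- The final estimate

codes-bound : ∀ z L n → 2 ≤ n → 2 ^ L ≤ 2 * n → 
  2 ^ suc (suc z * (suc z * (1 + 2 * ((L * 3) * 6))) + 2 * (suc z * ((L * 3) * 10))) ≤ n ^
      (73 * (z + 2) ^ 2)
codes-bound z L n 2≤n 2^L≤2n = begin
  2 ^ suc (suc z * (suc z * (1 + 2 * ((L * 3) * 6))) + 2 * (suc z * ((L * 3) * 10)))
    ≡⟨ cong (2 ^_) expand ⟩
  2 ^ (a + L * b)                ≡⟨ ^-distribˡ-+-* 2 a (L * b) ⟩
  2 ^ a * 2 ^ (L * b)            ≡⟨ cong (2 ^ a *_) (^-*-assoc 2 L b) ⟨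
  -- Since 2 ^ L ≤ 2 n ≤ n ², each factor 2 ^ L costs two factors of n.
  2 ^ a * (2 ^ L) ^ b            ≤⟨ *-mono-≤ (^-monoˡ-≤ a 2≤n)
      (^-monoˡ-≤ b (≤-trans 2^L≤2n (*-monoˡ-≤ n 2≤n))) ⟩
  n ^ a * (n * n) ^ b            ≡⟨ cong (λ m → n ^ a * (n * m) ^ b) (*-identityʳ n) ⟨
  n ^ a * (n ^ 2) ^ b            ≡⟨ cong (n ^ a *_) (^-*-assoc n 2 b) ⟩
  n ^ a * n ^ (2 * b)            ≡⟨ ^-distribˡ-+-* n a (2 * b) ⟨
  n ^ (a + 2 * b)                ≤⟨ ^-monoʳ-≤ n {{>-nonZero (<⇒≤ 2≤n)}} exponent ⟩
  n ^ (73 * (z + 2) ^ 2)         ∎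
  where
  open ≤-Reasoning
  a b : ℕ
  a = 1 + suc z * suc z
  b = 36 * (suc z * suc z) + 60 * suc z
  expand : suc (suc z * (suc z * (1 + 2 * ((L * 3) * 6))) + 2 * (suc z * ((L * 3) * 10))) ≡
           (1 + suc z * suc z) + L * (36 * (suc z * suc z) + 60 * suc z)
  expand = solve (z ∷ L ∷ [])
  exponent : (1 + suc z * suc z) + 2 * (36 * (suc z * suc z) + 60 * suc z) ≤ 73 * (z + 2) ^ 2
  exponent = begin
    (1 + suc z * suc z) + 2 * (36 * (suc z * suc z) + 60 * suc z)
      -- The constant 73 is 1 + 2 * 36, and the slack is the exact difference of the two quadratics.
      ≤⟨ m≤m+n _ (26 * z + 98) ⟩
    (1 + suc z * suc z) + 2 * (36 * (suc z * suc z) + 60 * suc z) + (26 * z + 98)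
      ≡⟨ solve (z ∷ []) ⟩
    73 * ((z + 2) * ((z + 2) * 1))  ∎

corollary5 : ∀ {a ℓ : Level} {A : Set a} {_≺_ : Rel (Maybe A) ℓ}
    (≺-sto : IsStrictTotalOrder _≡_ _≺_)
    (S : List A) → 2 ≤ length S →
    (Fs : List (List A)) → IsLZ77 S Fs →
    (π : Permutation′ (suc (length S))) → SortsRotations _≺_ S π →
    runs (IsStrictTotalOrder._≟_ ≺-sto) (bwt S π) ≤ 73 * (length Fs + 2) ^ 2 ·log₂ length S
corollary5 ≺-sto S@(_ ∷ S′) 2≤n Fs lz π sorted with logarithm (length S′)
... | L , n<2^L , 2^L≤2n = ≤-trans
  (^-monoʳ-≤ 2 (Counting.runs≤ ≺-sto S Fs lz π sorted L n<2^L))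
  (codes-bound (length Fs) L (length S) 2≤n 2^L≤2n)
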